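{- There is a data structure using $O(nd^2)$ space for the Online Quadratic-Form Sampling Problem supporting the following operations: $\textsc{Init}(n,d,\{v_1,\dots,v_n\}\subset\mathbb{R}^d,\{\alpha_1,\dots,\alpha_n\}\subset\mathbb{R})$ preprocesses in time $O(nd^2)$; and $\textsc{Query}(A)$, given a positive semidefinite matrix $A\in\mathbb{R}^{d\times d}$, outputs a sample $i\in[n]$ distributed exactly according to $\mathcal{D}_A$, in time $O(d^2\log n)$.
   Context: Online Quadratic-Form Sampling Problem: given $n$ vectors $v_1,\dots,v_n\in\mathbb{R}^d$ and $n$ coefficients $\alpha_1,\dots,\alpha_n$, for any queried positive semidefinite $A\in\mathbb{R}^{d\times d}$, output a sample $i\in[n]$ from the distribution $\mathcal{D}_A$ given by $\Pr_{\mathcal{D}_A}[i]=\frac{\alpha_i v_i^\top Av_i}{\sum_{j=1}^n\alpha_jv_j^\top Av_j}$ for $i\in[n]$. -}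

module Defs where

open import Algebra.Bundles using (CommutativeRing)
import Algebra.Properties.Semiring.Sum as Sum
open import Data.Bool.Base using (Bool; true; false; if_then_else_)
open import Data.Fin.Base using (Fin; toℕ; fromℕ<)
open import Data.List.Base using (List; []; _∷_; _++_)
open import Data.Maybe.Base as Maybe using (Maybe; just; nothing; zipWith; _>>=_)
open import Data.Nat.Base as ℕ using (ℕ; zero; suc; _≡ᵇ_; _<ᵇ_; _≤ᵇ_)
import Data.Nat.Properties as ℕ
open import Data.Product.Base using (∃; _×_; _,_)
open import Data.Vec.Functional using (Vector; concat; updateAt)
open import Function.Base using (const)
open import Level using (Level; _⊔_) renaming (suc to lsuc)
open import Relation.Binary.Bundles using (StrictTotalOrder)
open import Relation.Binary.Core using (Rel)
open import Relation.Binary.PropositionalEquality.Core using (_≡_)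
open import Relation.Binary.Structures using (IsStrictTotalOrder)
import Relation.Binary.Construct.StrictToNonStrict as ToNonStrict
open import Relation.Nullary.Decidable.Core using (Dec; yes; no; does)
open import Relation.Nullary.Negation.Core using (¬_)
open import Relation.Unary using (Pred)

-- The classical axioms of a complete ordered field, which determine ℝ up to
-- isomorphism.  Trichotomy is part of IsStrictTotalOrder, and the value of
-- 0# ⁻¹ is unconstrained.
record Reals (c ℓ₁ ℓ₂ : Level) : Set (lsuc (c ⊔ ℓ₁ ⊔ ℓ₂)) where
  field
    commutativeRing : CommutativeRing c ℓ₁

  open CommutativeRing commutativeRing public renaming (Carrier to ℝ)

  infix 4 _<_
  infix 8 _⁻¹
  field
    _<_                : Rel ℝ ℓ₂
    isStrictTotalOrder : IsStrictTotalOrder _≈_ _<_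
    0<1                : 0# < 1#
    +-monoˡ-<          : ∀ z {x y} → x < y → x + z < y + z
    *-pos              : ∀ {x y} → 0# < x → 0# < y → 0# < x * y
    _⁻¹                : ℝ → ℝ
    ⁻¹-inverseʳ        : ∀ {x} → ¬ (x ≈ 0#) → x * x ⁻¹ ≈ 1#

  open ToNonStrict _≈_ _<_ public using (_≤_)

  strictTotalOrder : StrictTotalOrder c ℓ₁ ℓ₂
  strictTotalOrder = record { isStrictTotalOrder = isStrictTotalOrder }

  open StrictTotalOrder strictTotalOrder public using (compare; _≟_; _<?_)

  UpperBound : Pred ℝ (c ⊔ ℓ₁ ⊔ ℓ₂) → ℝ → Set (c ⊔ ℓ₁ ⊔ ℓ₂)
  UpperBound P u = ∀ {x} → P x → x ≤ u

  field
    supremum : ∀ (P : Pred ℝ (c ⊔ ℓ₁ ⊔ ℓ₂)) → ∃ P → ∃ (UpperBound P) →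
               ∃ λ u → UpperBound P u × (∀ {w} → UpperBound P w → u ≤ w)

-- Programs of a randomised real RAM.  The syntax mentions neither ℝ nor the
-- sizes n and d, so one program serves all sizes.  Real numbers occur at run
-- time only, and nothing converts a real number to a word.

Var : Set
Var = ℕ

infix  6 _≔_ memory[_]≔_ _<ʷ_ _<ˢ_
infixl 7 _⊕_ _⊖_ _⊞_ _⊟_
infixl 8 _⊗_ _⊠_ _⊘_
infix  9 _[_]

data Word : Set where
  var         : Var → Word
  lit         : ℕ → Word
  _⊕_ _⊖_ _⊗_ : Word → Word → Word     -- ⊖ is truncated subtraction

data Array : Set where
  input₁ input₂ memory : Array

data Scalar : Set where
  zeroˢ oneˢ         : Scalar
  _[_]               : Array → Word → Scalar
  _⊞_ _⊟_ _⊠_ _⊘_   : Scalar → Scalar → Scalar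

data Test : Set where
  _<ʷ_ : Word → Word → Test
  _<ˢ_ : Scalar → Scalar → Test

data Command : Set where
  _≔_          : Var → Word → Command
  memory[_]≔_  : Word → Scalar → Command
  cond         : Test → List Command → List Command → Command
  while        : Test → List Command → Command
  -- flip p a b: run a with probability p and b with probability 1 - p,
  -- independently of all earlier flips
  flip         : Scalar → List Command → List Command → Command

Program : Set
Program = List Command

-- On entry variables 0 and 1 hold n and d; the result is read from variable 2.
nVar dVar resultVar : Var
nVar      = 0
dVar      = 1
resultVar = 2

Env : Set
Env = Var → ℕ

initialEnv : ℕ → ℕ → Env
initialEnv n d 0 = n
initialEnv n d 1 = d
initialEnv n d _ = 0

_[_↦_] : Env → Var → ℕ → Env
(ρ [ x ↦ w ]) y = if y ≡ᵇ x then w else ρ y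

evalWord : Env → Word → ℕ
evalWord ρ (var x) = ρ x
evalWord ρ (lit k) = k
evalWord ρ (e ⊕ f) = evalWord ρ e ℕ.+ evalWord ρ f
evalWord ρ (e ⊖ f) = evalWord ρ e ℕ.∸ evalWord ρ f
evalWord ρ (e ⊗ f) = evalWord ρ e ℕ.* evalWord ρ f

address : (l : ℕ) → ℕ → Maybe (Fin l)
address l a with a ℕ.<? l
... | yes a<l = just (fromℕ< a<l)
... | no  _   = nothing

module Machine {c ℓ₁ ℓ₂} (R : Reals c ℓ₁ ℓ₂) where

  open Reals R

  -- The two input arrays are read-only.
  record Inputs : Set c where
    constructor inputs
    field
      {size₁ size₂} : ℕ
      array₁        : Vector ℝ size₁
      array₂        : Vector ℝ size₂

  -- S is the number of real memory cells and also the largest word that may be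
  -- stored in a variable, so words have O(log S) bits.
  record State (S : ℕ) : Set c where
    constructor ⟨_,_⟩
    field
      env : Env
      mem : Vector ℝ S

  open State public

  Config : ℕ → Set c
  Config S = Program × State S

  data Outcome (S : ℕ) : Set c where
    next   : Config S → Outcome S
    branch : ℝ → Config S → Config S → Outcome S
    fault  : Outcome S

  module Semantics (I : Inputs) {S : ℕ} where

    open Inputs I

    read : State S → Array → ℕ → Maybe ℝ
    read σ input₁ a = Maybe.map array₁ (address size₁ a)
    read σ input₂ a = Maybe.map array₂ (address size₂ a)
    read σ memory a = Maybe.map (mem σ) (address S a)

    divide : ℝ → ℝ → Maybe ℝ
    divide x y = if does (y ≟ 0#) then nothing else just (x * y ⁻¹)

    evalScalar : State S → Scalar → Maybe ℝ
    evalScalar σ zeroˢ     = just 0#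
    evalScalar σ oneˢ      = just 1#
    evalScalar σ (a [ e ]) = read σ a (evalWord (env σ) e)
    evalScalar σ (r ⊞ s)   = zipWith _+_ (evalScalar σ r) (evalScalar σ s)
    evalScalar σ (r ⊟ s)   = zipWith _-_ (evalScalar σ r) (evalScalar σ s)
    evalScalar σ (r ⊠ s)   = zipWith _*_ (evalScalar σ r) (evalScalar σ s)
    evalScalar σ (r ⊘ s)   =
      evalScalar σ r >>= λ x → evalScalar σ s >>= λ y → divide x y

    evalTest : State S → Test → Maybe Bool
    evalTest σ (e <ʷ f) = just (evalWord (env σ) e <ᵇ evalWord (env σ) f)
    evalTest σ (r <ˢ s) =
      zipWith (λ x y → does (x <? y)) (evalScalar σ r) (evalScalar σ s)

    assign : Var → ℕ → Program → State S → Outcome S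
    assign x w K ⟨ ρ , m ⟩ =
      if w ≤ᵇ S then next (K , ⟨ ρ [ x ↦ w ] , m ⟩) else fault

    store : Maybe (Fin S) → Maybe ℝ → Program → State S → Outcome S
    store (just a) (just x) K ⟨ ρ , m ⟩ = next (K , ⟨ ρ , updateAt m a (const x) ⟩)
    store _        _        K σ         = fault

    choose : Maybe Bool → Program → Program → State S → Outcome S
    choose (just true)  K L σ = next (K , σ)
    choose (just false) K L σ = next (L , σ)
    choose nothing      K L σ = fault

    -- A flip faults unless 0 ≤ p ≤ 1.
    toss : Maybe ℝ → Program → Program → State S → Outcome S
    toss nothing  K L σ = fault
    toss (just p) K L σ =
      if does (p <? 0#) then fault else
      if does (1# <? p) then fault else
      branch p (K , σ) (L , σ)

    -- K is the rest of the program.  Expressions have constant size within a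
    -- fixed program, so every step is O(1) real RAM operations.
    step : Command → Program → State S → Outcome S
    step (x ≔ e)          K σ = assign x (evalWord (env σ) e) K σ
    step (memory[ e ]≔ r) K σ =
      store (address S (evalWord (env σ) e)) (evalScalar σ r) K σ
    step (cond t a b)     K σ = choose (evalTest σ t) (a ++ K) (b ++ K) σ
    step (while t a)      K σ =
      choose (evalTest σ t) (a ++ while t a ∷ K) K σ
    step (flip r a b)     K σ = toss (evalScalar σ r) (a ++ K) (b ++ K) σ

    -- The final state, if the program halts within T steps without faulting
    -- and without flipping a coin.
    mutual
      run : (T : ℕ) → Config S → Maybe (State S)
      run T       ([]    , σ) = just σ
      run zero    (_ ∷ _ , σ) = nothing
      run (suc T) (a ∷ K , σ) = runOutcome T (step a K σ)

      runOutcome : ℕ → Outcome S → Maybe (State S)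
      runOutcome T (next κ)       = run T κ
      runOutcome T (branch p _ _) = nothing
      runOutcome T fault          = nothing

    -- The probability that the program halts within T steps with result i.
    -- Faulting and exceeding T steps contribute to no result.
    mutual
      probability : (T : ℕ) → Config S → (i : ℕ) → ℝ
      probability T       ([]    , σ) i = if env σ resultVar ≡ᵇ i then 1# else 0#
      probability zero    (_ ∷ _ , σ) i = 0#
      probability (suc T) (a ∷ K , σ) i = outcomeProbability T (step a K σ) i

      outcomeProbability : ℕ → Outcome S → ℕ → ℝ
      outcomeProbability T (next κ)       i = probability T κ i
      outcomeProbability T (branch p κ κ') i =
        p * probability T κ i + (1# - p) * probability T κ' i
      outcomeProbability T fault          i = 0#

module QuadraticFormSampling {c ℓ₁ ℓ₂} (R : Reals c ℓ₁ ℓ₂) where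

  open Reals R
  open Sum semiring using (sum)
  open Machine R

  Matrix : ℕ → Set c
  Matrix d = Vector (Vector ℝ d) d

  quadraticForm : ∀ {d} → Matrix d → Vector ℝ d → ℝ
  quadraticForm A x = sum λ j → sum λ k → x j * A j k * x k

  PositiveSemidefinite : ∀ {d} → Matrix d → Set (c ⊔ ℓ₁ ⊔ ℓ₂)
  PositiveSemidefinite A =
    (∀ j k → A j k ≈ A k j) × (∀ x → 0# ≤ quadraticForm A x)

  module _ {n d} (v : Vector (Vector ℝ d) n) (α : Vector ℝ n) (A : Matrix d) where

    weight : Vector ℝ n
    weight i = α i * quadraticForm A (v i)

    𝒟 : Vector ℝ n
    𝒟 i = weight i * sum weight ⁻¹

    -- The entries of 𝒟 then automatically sum to 1.
    IsDistribution : Set (ℓ₁ ⊔ ℓ₂)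
    IsDistribution = ¬ (sum weight ≈ 0#) × (∀ i → 0# ≤ 𝒟 i)

  -- Run on the vectors (concatenated) and the coefficients from memory with
  -- arbitrary contents, init halts within T steps in the state σ.
  Preprocesses : ∀ {n d S} → Program → (T : ℕ) →
                 Vector (Vector ℝ d) n → Vector ℝ n → Vector ℝ S → State S → Set c
  Preprocesses {n} {d} init T v α m σ =
    run T (init , ⟨ initialEnv n d , m ⟩) ≡ just σ
    where
    open Semantics (inputs (concat v) α)


  -- Run on A (row by row) and the read-only data structure D, with S further
  -- memory cells of arbitrary contents m as workspace, query halts within T
  -- steps with a result i < n distributed as 𝒟.  As D is unchanged, m is
  -- arbitrary and coin flips are fresh, this covers every sequence of queries,
  -- adaptive ones included.
  Samples : ∀ {n d S} → Program → (T : ℕ) →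
            Vector (Vector ℝ d) n → Vector ℝ n → Vector ℝ S → Matrix d → Set (c ⊔ ℓ₁)
  Samples {n} {d} {S} query T v α D A =
    ∀ (m : Vector ℝ S) (i : Fin n) →
    probability T (query , ⟨ initialEnv n d , m ⟩) (toℕ i) ≈ 𝒟 v α A i
    where open Semantics (inputs (concat A) D)

{-# OPTIONS --safe #-}
-- Keep a binary tree with one leaf for each i and store at every node the sum
-- of αᵢ vᵢ vᵢᵀ over the leaves below it.  The Frobenius inner product of A with
-- this matrix is the total weight of the subtree, so walking down from the root
-- and choosing each child with its conditional probability samples from 𝒟.  The
-- tree is laid out as a heap, so that children are found without division and
-- the depth is ⌈log₂ n⌉ for every n.  Multiplying the probability that the walk
-- from node j outputs i by the mass below j gives the mass of i below j, by
-- induction along the walk and without dividing by a mass that may vanish.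

module Submission where

open import Defs
import Algebra.Properties.CommutativeSemigroup as CommutativeSemigroupProperties
import Algebra.Properties.Group as GroupProperties
import Algebra.Properties.Semiring.Sum as Sum
open import Data.Bool.Base using (true; false; if_then_else_; T)
open import Data.Bool.Properties using (T-≡)
open import Data.Fin.Base using (zero; suc; toℕ; fromℕ<; combine)
import Data.Fin.Properties as Fin
open import Data.List.Base using ([]; _∷_; _++_)
open import Data.Maybe.Base as Maybe using (just)
open import Data.Nat.Base as ℕ using (ℕ; zero; suc; z≤n; s≤s; NonZero)
open import Data.Nat.Induction using (<-wellFounded)
open import Data.Nat.Logarithm using (⌈log₂_⌉)
open import Data.Nat.Logarithm.Core using (⌈log2⌉)
import Data.Nat.Properties as ℕ
open import Data.Nat.Tactic.RingSolver using (solve-∀)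
open import Data.Product.Base using (∃-syntax; _×_; _,_; proj₁; proj₂; uncurry)
open import Data.Sum.Base using (_⊎_; inj₁; inj₂)
open import Data.Vec.Functional using (Vector; concat; updateAt)
open import Data.Vec.Functional.Properties using (updateAt-updates; updateAt-minimal)
open import Function.Base using (_∘_; const)
open import Function.Bundles using (Equivalence)
open import Induction.WellFounded using (Acc; acc)
open import Level using (Level)
open import Relation.Binary.Definitions using (tri<; tri≈; tri>)
open import Relation.Binary.PropositionalEquality as ≡
  using (_≡_; _≢_; refl; cong; cong₂; subst; module ≡-Reasoning)
open import Relation.Binary.Structures using (IsStrictTotalOrder)
open import Relation.Nullary.Decidable using (yes; no; dec-false)
open import Relation.Nullary.Negation.Core using (¬_; contradiction)
open import Relation.Unary using (Pred)

-- The masses have no fixed sign: a distribution requires only a nonzero total and nonnegative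
-- quotients, so all weights may be nonpositive. Every order argument therefore concerns the masses
-- divided by the total weight, which are nonnegative at each node. The program still divides raw
-- masses, because the total cancels from the ratio. A node of mass zero makes the division fault,
-- so nothing can be said about the output from there. The scaled invariant survives since its
-- target, the probability of lying below the node and equalling i, is squeezed between zero and the
-- normalised mass. At the root the normalised mass is one and the scaling disappears. The tree is
-- traversed under two measures. The linear bound `n ≤ j + fuel` is enough for definitions and
-- inequalities; the running time needs the logarithmic bound `suc n ≤ suc j * 2 ^ f`. Throughout,
-- the number of vectors is written `suc n`, so that `n` counts the inner nodes.

module _ where
  open import Data.Nat.Base using (_+_; _*_; _∸_; _^_; _≤_; _<_; ⌈_/2⌉; ⌊_/2⌋)

  -- Arithmetic of logarithms, addresses and heap indices

  n≤2*⌈n/2⌉ : ∀ n → n ≤ 2 * ⌈ n /2⌉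
  n≤2*⌈n/2⌉ n = begin
    n                      ≡⟨ ℕ.⌊n/2⌋+⌈n/2⌉≡n n ⟨
    ⌊ n /2⌋ + ⌈ n /2⌉      ≤⟨ ℕ.+-monoˡ-≤ ⌈ n /2⌉ (ℕ.⌊n/2⌋≤⌈n/2⌉ n) ⟩
    ⌈ n /2⌉ + ⌈ n /2⌉      ≡⟨ cong (⌈ n /2⌉ +_) (ℕ.+-identityʳ _) ⟨
    2 * ⌈ n /2⌉            ∎
    where open ℕ.≤-Reasoning

  -- The logarithm recurses by halving upwards, and doubling the rounded half recovers at least n.
  -- The accessibility proof is kept explicit so that this recursion unfolds.
  n≤2^⌈log₂n⌉ : ∀ n → n ≤ 2 ^ ⌈log₂ n ⌉
  n≤2^⌈log₂n⌉ n = go n (<-wellFounded n)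
    where
    go : ∀ n (rec : Acc _<_ n) → n ≤ 2 ^ ⌈log2⌉ n rec
    go 0             _        = z≤n
    go 1             _        = s≤s z≤n
    go (suc (suc n)) (acc rs) =
      ℕ.≤-trans (n≤2*⌈n/2⌉ (suc (suc n)))
        (ℕ.*-monoʳ-≤ 2 (go (suc ⌈ n /2⌉) (rs (ℕ.⌈n/2⌉<n n))))

  digits-< : ∀ {d m a b} → a < m → b < d → d * a + b < d * m
  digits-< {d} {m} {a} {b} a<m b<d = begin-strict
    d * a + b  <⟨ ℕ.+-monoʳ-< (d * a) b<d ⟩
    d * a + d  ≡⟨ ℕ.+-comm (d * a) d ⟩
    d + d * a  ≡⟨ ℕ.*-suc d a ⟨
    d * suc a  ≤⟨ ℕ.*-monoʳ-≤ d a<m ⟩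
    d * m      ∎
    where open ℕ.≤-Reasoning

  -- A smaller leading digit makes the number smaller whatever the trailing digits are. This is why
  -- distinct matrix entries occupy distinct cells.
  digits-injective : ∀ {d} a a′ {b b′} → b < d → b′ < d →
                     d * a + b ≡ d * a′ + b′ → a ≡ a′ × b ≡ b′
  digits-injective {d} a a′ {b} {b′} b<d b′<d eq with ℕ.<-cmp a a′
  ... | tri≈ _ refl _ = refl , ℕ.+-cancelˡ-≡ (d * a) b b′ eq
  ... | tri< a<a′ _ _ = contradiction eq
    (ℕ.<⇒≢ (ℕ.<-≤-trans (digits-< a<a′ b<d) (ℕ.m≤m+n (d * a′) b′)))
  ... | tri> _ _ a>a′ = contradiction (≡.sym eq)
    (ℕ.<⇒≢ (ℕ.<-≤-trans (digits-< a>a′ b′<d) (ℕ.m≤m+n (d * a) b)))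

  -- Nodes are numbered from the root 0 downwards, level by level.  With n + 1
  -- leaves, the nodes below n are inner and the leaves are n, …, n + n.
  leftChild rightChild : ℕ → ℕ
  leftChild  j = j + j + 1
  rightChild j = j + j + 2

  rightChild≡ : ∀ j → j + j + 2 ≡ suc j + suc j
  rightChild≡ = solve-∀

  leftChild≡ : ∀ j → j + j + 1 ≡ j + suc j
  leftChild≡ = solve-∀

  rightChild-≤ : ∀ {n j} → j < n → rightChild j ≤ n + n
  rightChild-≤ {j = j} j<n rewrite rightChild≡ j = ℕ.+-mono-≤ j<n j<n

  leftChild-≤ : ∀ {n j} → j < n → leftChild j ≤ n + n
  leftChild-≤ {j = j} j<n rewrite leftChild≡ j = ℕ.+-mono-≤ (ℕ.<⇒≤ j<n) j<n

  -- A child has a strictly larger index than its parent, which pays for the unit of fuel spent on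
  -- the descent.
  leftChild-fuel : ∀ {n j f} → n ≤ j + suc f → n ≤ leftChild j + f
  leftChild-fuel {n} {j} {f} le = begin
    n                ≤⟨ le ⟩
    j + suc f        ≡⟨ ℕ.+-suc j f ⟩
    suc j + f        ≤⟨ ℕ.+-monoˡ-≤ f (ℕ.m≤n+m (suc j) j) ⟩
    j + suc j + f    ≡⟨ cong (_+ f) (leftChild≡ j) ⟨
    leftChild j + f  ∎
    where open ℕ.≤-Reasoning

  leftChild<rightChild : ∀ j → leftChild j < rightChild j
  leftChild<rightChild j = ℕ.+-monoʳ-< (j + j) ℕ.≤-refl

  rightChild-fuel : ∀ {n j f} → n ≤ j + suc f → n ≤ rightChild j + f
  rightChild-fuel {n} {j} {f} le =
    ℕ.≤-trans (leftChild-fuel le) (ℕ.+-monoˡ-≤ f (ℕ.<⇒≤ (leftChild<rightChild j)))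

  node<leftChild : ∀ j → j < leftChild j
  node<leftChild j rewrite leftChild≡ j = ℕ.m≤n+m (suc j) j

  node<rightChild : ∀ j → j < rightChild j
  node<rightChild j = ℕ.<-trans (node<leftChild j) (leftChild<rightChild j)

  -- Counted from 1, the children of J are 2J and 2J + 1, so each level doubles the index at least.
  -- Applied with `suc n` in place of `n`, the bound at f = 0 says that j is not an inner node.
  leftChild-depth : ∀ {n j} f → n ≤ suc j * 2 ^ suc f → n ≤ suc (leftChild j) * 2 ^ f
  leftChild-depth {n} {j} f le = ℕ.≤-trans le (ℕ.≤-reflexive (lemma j (2 ^ f)))
    where
    lemma : ∀ j p → suc j * (2 * p) ≡ suc (j + j + 1) * p
    lemma = solve-∀

  rightChild-depth : ∀ {n j} f → n ≤ suc j * 2 ^ suc f → n ≤ suc (rightChild j) * 2 ^ f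
  rightChild-depth {n} {j} f le =
    ℕ.≤-trans (leftChild-depth {j = j} f le)
      (ℕ.*-monoˡ-≤ (2 ^ f) (ℕ.<⇒≤ (s≤s (leftChild<rightChild j))))

-- Finite sums over initial segments of the naturals

module FiniteSums {c ℓ₁ ℓ₂} (R : Reals c ℓ₁ ℓ₂) where

  open Reals R using
    ( ℝ; _≈_; _+_; _*_; 0#; 1#; setoid; semiring; +-commutativeSemigroup
    ; +-cong; +-congˡ; +-congʳ; +-assoc; +-comm; +-identityˡ; +-identityʳ
    ; *-identityˡ; zeroˡ; zeroʳ; distribˡ)
    renaming (refl to ≈-refl; sym to ≈-sym; trans to ≈-trans)
  open CommutativeSemigroupProperties +-commutativeSemigroup using (interchange)
  open Sum semiring using (sum)
  open import Relation.Binary.Reasoning.Setoid setoid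

  Σ< : ℕ → (ℕ → ℝ) → ℝ
  Σ< zero    f = 0#
  Σ< (suc n) f = Σ< n f + f n

  Σ<-cong : ∀ n {f g} → (∀ {k} → k ℕ.< n → f k ≈ g k) → Σ< n f ≈ Σ< n g
  Σ<-cong zero    eq = ≈-refl
  Σ<-cong (suc n) eq = +-cong (Σ<-cong n (eq ∘ ℕ.m<n⇒m<1+n)) (eq ℕ.≤-refl)

  Σ<-+ : ∀ n f g → Σ< n (λ k → f k + g k) ≈ Σ< n f + Σ< n g
  Σ<-+ zero    f g = ≈-sym (+-identityˡ 0#)
  Σ<-+ (suc n) f g = ≈-trans (+-congʳ (Σ<-+ n f g)) (interchange _ _ _ _)

  *-distribˡ-Σ< : ∀ n x f → x * Σ< n f ≈ Σ< n (λ k → x * f k)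
  *-distribˡ-Σ< zero    x f = zeroʳ x
  *-distribˡ-Σ< (suc n) x f = ≈-trans (distribˡ x _ _) (+-congʳ (*-distribˡ-Σ< n x f))

  Σ<-head : ∀ n f → Σ< (suc n) f ≈ f 0 + Σ< n (f ∘ suc)
  Σ<-head zero    f = +-comm 0# (f 0)
  Σ<-head (suc n) f = ≈-trans (+-congʳ (Σ<-head n f)) (+-assoc _ _ _)

  Σ<-append : ∀ m n f → Σ< (m ℕ.+ n) f ≈ Σ< m f + Σ< n (f ∘ (m ℕ.+_))
  Σ<-append m zero    f rewrite ℕ.+-identityʳ m = ≈-sym (+-identityʳ _)
  Σ<-append m (suc n) f rewrite ℕ.+-suc m n = ≈-trans (+-congʳ (Σ<-append m n f)) (+-assoc _ _ _)

  Σ<-digits : ∀ m d f → Σ< (d ℕ.* m) f ≈ Σ< m λ a → Σ< d λ b → f (d ℕ.* a ℕ.+ b)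
  Σ<-digits zero    d f rewrite ℕ.*-zeroʳ d = ≈-refl
  Σ<-digits (suc m) d f rewrite ℕ.*-suc d m | ℕ.+-comm d (d ℕ.* m) =
    ≈-trans (Σ<-append (d ℕ.* m) d f) (+-congʳ (Σ<-digits m d f))

  Σ<≈sum : ∀ {n} {f : ℕ → ℝ} {g : Vector ℝ n} → (∀ i → f (toℕ i) ≈ g i) → Σ< n f ≈ sum g
  Σ<≈sum {zero}  eq = ≈-refl
  Σ<≈sum {suc n} eq = ≈-trans (Σ<-head n _) (+-cong (eq zero) (Σ<≈sum (eq ∘ suc)))

  -- Written exactly as `probability` evaluates a halted configuration, so that the two agree by
  -- computation at a leaf.
  indicator : ℕ → ℕ → ℝ
  indicator i k = if k ℕ.≡ᵇ i then 1# else 0#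

  Σ<-indicator : ∀ {n i} (f : ℕ → ℝ) → i ℕ.< n → Σ< n (λ k → indicator i k * f k) ≈ f i
  Σ<-indicator {suc n} {zero} f _ = begin
    Σ< (suc n) (λ k → indicator 0 k * f k)
      ≈⟨ Σ<-head n _ ⟩
    1# * f 0 + Σ< n (λ k → 0# * f (suc k))
      ≈⟨ +-cong (*-identityˡ _) (≈-sym (*-distribˡ-Σ< n 0# _)) ⟩
    f 0 + 0# * Σ< n (f ∘ suc)
      ≈⟨ +-congˡ (zeroˡ _) ⟩
    f 0 + 0#
      ≈⟨ +-identityʳ _ ⟩
    f 0 ∎
  Σ<-indicator {suc n} {suc i} f (s≤s i<n) = begin
    Σ< (suc n) (λ k → indicator (suc i) k * f k)
      ≈⟨ Σ<-head n _ ⟩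
    0# * f 0 + Σ< n (λ k → indicator i k * f (suc k))
      ≈⟨ +-cong (zeroˡ _) (Σ<-indicator (f ∘ suc) i<n) ⟩
    0# + f (suc i)
      ≈⟨ +-identityˡ _ ⟩
    f (suc i) ∎

-- Inequalities in an ordered field

module Order {c ℓ₁ ℓ₂} (R : Reals c ℓ₁ ℓ₂) where

  open Reals R
    renaming (refl to ≈-refl; sym to ≈-sym; trans to ≈-trans; reflexive to ≈-reflexive)
  open IsStrictTotalOrder isStrictTotalOrder using (irrefl; <-respˡ-≈; <-respʳ-≈)
    renaming (trans to <-trans)

  <⇒≱ : ∀ {x y} → x < y → ¬ (y ≤ x)
  <⇒≱ x<y (inj₁ y<x) = irrefl ≈-refl (<-trans x<y y<x)
  <⇒≱ x<y (inj₂ y≈x) = irrefl (≈-sym y≈x) x<y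

  ≤-respˡ-≈ : ∀ {x y z} → x ≈ y → x ≤ z → y ≤ z
  ≤-respˡ-≈ x≈y (inj₁ x<z) = inj₁ (<-respˡ-≈ x≈y x<z)
  ≤-respˡ-≈ x≈y (inj₂ x≈z) = inj₂ (≈-trans (≈-sym x≈y) x≈z)

  ≤-respʳ-≈ : ∀ {x y z} → y ≈ z → x ≤ y → x ≤ z
  ≤-respʳ-≈ y≈z (inj₁ x<y) = inj₁ (<-respʳ-≈ y≈z x<y)
  ≤-respʳ-≈ y≈z (inj₂ x≈y) = inj₂ (≈-trans x≈y y≈z)

  +-monoʳ-< : ∀ z {x y} → x < y → z + x < z + y
  +-monoʳ-< z {x} {y} x<y = <-respˡ-≈ (+-comm x z) (<-respʳ-≈ (+-comm y z) (+-monoˡ-< z x<y))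

  +-mono-≤ : ∀ {x y u v} → x ≤ y → u ≤ v → x + u ≤ y + v
  +-mono-≤ {y = y} {u} (inj₁ x<y) (inj₁ u<v) = inj₁ (<-trans (+-monoˡ-< u x<y) (+-monoʳ-< y u<v))
  +-mono-≤ {y = y} {u} (inj₁ x<y) (inj₂ u≈v) = inj₁ (<-respʳ-≈ (+-congˡ u≈v) (+-monoˡ-< u x<y))
  +-mono-≤ {x} (inj₂ x≈y) (inj₁ u<v) = inj₁ (<-respʳ-≈ (+-congʳ x≈y) (+-monoʳ-< x u<v))
  +-mono-≤ (inj₂ x≈y) (inj₂ u≈v) = inj₂ (+-cong x≈y u≈v)

  antisym-0 : ∀ {x} → 0# ≤ x → x ≤ 0# → x ≈ 0#
  antisym-0 (inj₂ 0≈x) _   = ≈-sym 0≈x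
  antisym-0 (inj₁ 0<x) x≤0 = contradiction x≤0 (<⇒≱ 0<x)

  *-monoˡ-< : ∀ {x y z} → 0# < z → x < y → x * z < y * z
  *-monoˡ-< {x} {y} {z} 0<z x<y =
    <-respˡ-≈ (+-identityˡ _) (<-respʳ-≈ cancel (+-monoˡ-< (x * z) 0<[y-x]z))
    where
    0<y-x : 0# < y - x
    0<y-x = <-respˡ-≈ (-‿inverseʳ x) (+-monoˡ-< (- x) x<y)
    0<[y-x]z : 0# < (y - x) * z
    0<[y-x]z = *-pos 0<y-x 0<z
    cancel : (y - x) * z + x * z ≈ y * z
    cancel = ≈-trans (≈-sym (distribʳ z (y - x) x)) (*-congʳ
      (≈-trans (+-assoc y (- x) x) (≈-trans (+-congˡ (-‿inverseˡ x)) (+-identityʳ y))))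

  -- If p is the conditional probability of a part of mass y of a whole of mass
  -- z, then p is a valid argument of flip.
  module _ {p y z} (pz≈y : p * z ≈ y) (0≤y : 0# ≤ y) (y≤z : y ≤ z) (0<z : 0# < z) where

    quotient≮0 : ¬ (p < 0#)
    quotient≮0 p<0 = <⇒≱ (<-respˡ-≈ pz≈y (<-respʳ-≈ (zeroˡ z) (*-monoˡ-< 0<z p<0))) 0≤y

    1≮quotient : ¬ (1# < p)
    1≮quotient 1<p = <⇒≱ (<-respˡ-≈ (*-identityˡ z) (<-respʳ-≈ pz≈y (*-monoˡ-< 0<z 1<p))) y≤z

-- Identities for conditional probabilities

module FieldIdentities {c ℓ₁ ℓ₂} (R : Reals c ℓ₁ ℓ₂) where

  open Reals R
    renaming (refl to ≈-refl; sym to ≈-sym; trans to ≈-trans; reflexive to ≈-reflexive)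
  open CommutativeSemigroupProperties *-commutativeSemigroup using (xy∙z≈y∙xz)
  open GroupProperties +-group using (∙-cancelʳ)
  open import Relation.Binary.Reasoning.Setoid setoid

  -- Both (1 - p) z + y and y′ + y equal z, so cancelling y gives (1 - p) z = y′. Thus a flip scaled
  -- by the mass of a node splits into its two outcomes, each scaled by the mass of a child.
  average : ∀ {p z y y′} P Q → p * z ≈ y → z ≈ y + y′ →
            (p * P + (1# - p) * Q) * z ≈ P * y + Q * y′
  average {p} {z} {y} {y′} P Q pz≈y z≈y+y′ = begin
    (p * P + (1# - p) * Q) * z       ≈⟨ distribʳ _ _ _ ⟩
    p * P * z + (1# - p) * Q * z     ≈⟨ +-cong (xy∙z≈y∙xz p P z) (xy∙z≈y∙xz (1# - p) Q z) ⟩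
    P * (p * z) + Q * ((1# - p) * z) ≈⟨ +-cong (*-congˡ pz≈y) (*-congˡ (∙-cancelʳ y _ _ complement)) ⟩
    P * y + Q * y′                   ∎
    where
    complement : (1# - p) * z + y ≈ y′ + y
    complement = begin
      (1# - p) * z + y      ≈⟨ +-congˡ pz≈y ⟨
      (1# - p) * z + p * z  ≈⟨ distribʳ z _ _ ⟨
      (1# - p + p) * z      ≈⟨ *-congʳ (+-assoc 1# (- p) p) ⟩
      (1# + (- p + p)) * z  ≈⟨ *-congʳ (+-congˡ (-‿inverseˡ p)) ⟩
      (1# + 0#) * z         ≈⟨ *-congʳ (+-identityʳ 1#) ⟩
      1# * z                ≈⟨ *-identityˡ z ⟩
      z                     ≈⟨ z≈y+y′ ⟩
      y + y′                ≈⟨ +-comm y y′ ⟩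
      y′ + y                ∎

  quotient-scaled : ∀ {x y} s → ¬ (x ≈ 0#) → y * x ⁻¹ * (x * s) ≈ y * s
  quotient-scaled {x} {y} s x≉0 = begin
    y * x ⁻¹ * (x * s)    ≈⟨ *-assoc _ _ _ ⟩
    y * (x ⁻¹ * (x * s))  ≈⟨ *-congˡ (*-assoc _ _ _) ⟨
    y * (x ⁻¹ * x * s)    ≈⟨ *-congˡ (*-congʳ (≈-trans (*-comm _ _) (⁻¹-inverseʳ x≉0))) ⟩
    y * (1# * s)          ≈⟨ *-congˡ (*-identityˡ s) ⟩
    y * s                 ∎

-- Additive labellings of the tree

module Heaps {c ℓ₁ ℓ₂} (R : Reals c ℓ₁ ℓ₂) where

  open Reals R
    renaming (refl to ≈-refl; sym to ≈-sym; trans to ≈-trans; reflexive to ≈-reflexive)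
  open Order R
  open FiniteSums R
  open import Relation.Binary.Reasoning.Setoid setoid

  -- No heap order is meant: the labelling is additive over children, and hence determined by its
  -- leaves.
  IsHeap : ℕ → (ℕ → ℝ) → Set ℓ₁
  IsHeap n F = ∀ {j} → j ℕ.< n → F j ≈ F (leftChild j) + F (rightChild j)

  -- By induction on k the root is the sum of the nodes k, …, k + k: going from
  -- k to k + 1 replaces node k by its two children.
  heap-root : ∀ {n F} → IsHeap n F → ∀ {k} → k ℕ.≤ n → F 0 ≈ Σ< (suc k) (λ i → F (k ℕ.+ i))
  heap-root         heap {zero}  _   = ≈-sym (+-identityˡ _)
  heap-root {F = F} heap {suc k} k<n = begin
    F 0
      ≈⟨ heap-root heap (ℕ.<⇒≤ k<n) ⟩
    Σ< (suc k) (λ i → F (k ℕ.+ i))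
      ≈⟨ Σ<-head k _ ⟩
    F (k ℕ.+ 0) + rest
      ≡⟨ cong (λ j → F j + rest) (ℕ.+-identityʳ k) ⟩
    F k + rest
      ≈⟨ +-congʳ (heap k<n) ⟩
    F (leftChild k) + F (rightChild k) + rest
      ≈⟨ +-comm _ _ ⟩
    rest + (F (leftChild k) + F (rightChild k))
      ≈⟨ +-assoc _ _ _ ⟨
    rest + F (leftChild k) + F (rightChild k)
      ≈⟨ +-cong (+-cong (Σ<-cong k shift) (≈-reflexive (cong F left≡)))
                (≈-reflexive (cong F (rightChild≡ k))) ⟩
    Σ< (suc (suc k)) (λ i → F (suc k ℕ.+ i)) ∎
    where
    rest = Σ< k (λ i → F (k ℕ.+ suc i))
    shift : ∀ {i} → i ℕ.< k → F (k ℕ.+ suc i) ≈ F (suc k ℕ.+ i)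
    shift {i} _ = ≈-reflexive (cong F (ℕ.+-suc k i))
    left≡ : leftChild k ≡ suc k ℕ.+ k
    left≡ = ≡.trans (leftChild≡ k) (ℕ.+-suc k k)

  -- Inequalities at two children add up to one at their parent. Against the zero labelling this
  -- turns nonnegative leaves into nonnegative nodes.
  heap-mono : ∀ {n F G} → IsHeap n F → IsHeap n G →
              (∀ {i} → i ℕ.≤ n → F (n ℕ.+ i) ≤ G (n ℕ.+ i)) →
              ∀ {j} → j ℕ.≤ n ℕ.+ n → F j ≤ G j
  heap-mono {n} {F} {G} heapF heapG leaves {j} = go n (ℕ.m≤n+m n j)
    where
    leaf : ∀ {j} → n ℕ.≤ j → j ℕ.≤ n ℕ.+ n → F j ≤ G j
    leaf n≤j j≤2n with ℕ.m≤n⇒∃[o]m+o≡n n≤j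
    ... | i , refl = leaves (ℕ.+-cancelˡ-≤ n i n j≤2n)

    go : ∀ fuel {j} → n ℕ.≤ j ℕ.+ fuel → j ℕ.≤ n ℕ.+ n → F j ≤ G j
    go zero       {j} le j≤2n = leaf (subst (n ℕ.≤_) (ℕ.+-identityʳ j) le) j≤2n
    go (suc fuel) {j} le j≤2n with j ℕ.<? n
    ... | no  j≮n = leaf (ℕ.≮⇒≥ j≮n) j≤2n
    ... | yes j<n = ≤-respˡ-≈ (≈-sym (heapF j<n)) (≤-respʳ-≈ (≈-sym (heapG j<n)) (+-mono-≤
      (go fuel (leftChild-fuel {j = j} le) (leftChild-≤ j<n))
      (go fuel (rightChild-fuel {j = j} le) (rightChild-≤ j<n))))

  0-isHeap : ∀ {n} → IsHeap n (λ _ → 0#)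
  0-isHeap _ = ≈-sym (+-identityˡ 0#)

  module _ (n : ℕ) (w : ℕ → ℝ) where

    private
      descend : ℕ → ℕ → ℝ
      descend zero       j = w (j ℕ.∸ n)
      descend (suc fuel) j with j ℕ.<? n
      ... | yes _ = descend fuel (leftChild j) + descend fuel (rightChild j)
      ... | no  _ = w (j ℕ.∸ n)

      -- Within the bound, fuel runs out only at leaves, where both clauses of `descend` agree, so
      -- its amount does not matter. This is what gives `fromLeaves` an unfolding equation with the
      -- same fuel on both sides.
      descend-stable : ∀ f g {j} → n ℕ.≤ j ℕ.+ f → n ℕ.≤ j ℕ.+ g → descend f j ≡ descend g j
      descend-stable zero    zero    _ _ = refl
      descend-stable zero    (suc g) {j} le _ with j ℕ.<? n
      ... | yes j<n = contradiction (subst (n ℕ.≤_) (ℕ.+-identityʳ j) le) (ℕ.<⇒≱ j<n)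
      ... | no  _   = refl
      descend-stable (suc f) zero {j} _ le with j ℕ.<? n
      ... | yes j<n = contradiction (subst (n ℕ.≤_) (ℕ.+-identityʳ j) le) (ℕ.<⇒≱ j<n)
      ... | no  _   = refl
      descend-stable (suc f) (suc g) {j} lef leg with j ℕ.<? n
      ... | yes _ = cong₂ _+_
        (descend-stable f g (leftChild-fuel {j = j} lef) (leftChild-fuel {j = j} leg))
        (descend-stable f g (rightChild-fuel {j = j} lef) (rightChild-fuel {j = j} leg))
      ... | no  _ = refl

      descend-inner : ∀ f {j} → j ℕ.< n →
                      descend (suc f) j ≡ descend f (leftChild j) + descend f (rightChild j)
      descend-inner f {j} j<n with j ℕ.<? n
      ... | yes _   = refl
      ... | no  j≮n = contradiction j<n j≮n

    fromLeaves : ℕ → ℝ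
    fromLeaves = descend n

    fromLeaves-leaf : ∀ {j} → n ℕ.≤ j → fromLeaves j ≡ w (j ℕ.∸ n)
    fromLeaves-leaf {j} n≤j =
      descend-stable n 0 (ℕ.m≤n+m n j) (subst (n ℕ.≤_) (≡.sym (ℕ.+-identityʳ j)) n≤j)

    fromLeaves-inner : ∀ {j} → j ℕ.< n →
                       fromLeaves j ≡ fromLeaves (leftChild j) + fromLeaves (rightChild j)
    fromLeaves-inner {j} j<n =
      ≡.trans (descend-stable n (suc n) (ℕ.m≤n+m n j) (ℕ.m≤n⇒m≤o+n j (ℕ.n≤1+n n)))
        (descend-inner n j<n)

    fromLeaves-isHeap : IsHeap n fromLeaves
    fromLeaves-isHeap j<n = ≈-reflexive (fromLeaves-inner j<n)

-- Boolean comparisons and vector access by natural numbers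

<ᵇ-true : ∀ {m n} → m ℕ.< n → (m ℕ.<ᵇ n) ≡ true
<ᵇ-true = Equivalence.to T-≡ ∘ ℕ.<⇒<ᵇ

<ᵇ-false : ∀ {m n} → ¬ (m ℕ.< n) → (m ℕ.<ᵇ n) ≡ false
<ᵇ-false {m} {n} = dec-false (m ℕ.<? n)

≤ᵇ-true : ∀ {m n} → m ℕ.≤ n → (m ℕ.≤ᵇ n) ≡ true
≤ᵇ-true = Equivalence.to T-≡ ∘ ℕ.≤⇒≤ᵇ

module Entries {a} {A : Set a} (default : A) where

  -- A total lookup lets specifications use the very addresses that the programs compute, with range
  -- proofs supplied only where a cell is accessed.
  entry : ∀ {l} → Vector A l → ℕ → A
  entry {l} f k = Maybe.maybe′ f default (address l k)

  address-< : ∀ {l k} (k<l : k ℕ.< l) → address l k ≡ just (fromℕ< k<l)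
  address-< {l} {k} k<l with k ℕ.<? l
  ... | yes k<l′ = cong just (Fin.fromℕ<-cong k k refl k<l′ k<l)
  ... | no  k≮l  = contradiction k<l k≮l

  entry-fromℕ< : ∀ {l k} (f : Vector A l) (k<l : k ℕ.< l) → entry f k ≡ f (fromℕ< k<l)
  entry-fromℕ< f k<l rewrite address-< k<l = refl

  entry-toℕ : ∀ {l} (f : Vector A l) i → entry f (toℕ i) ≡ f i
  entry-toℕ f i = ≡.trans (entry-fromℕ< f (Fin.toℕ<n i)) (cong f (Fin.fromℕ<-toℕ i (Fin.toℕ<n i)))

  map-address : ∀ {l k} (f : Vector A l) → k ℕ.< l → Maybe.map f (address l k) ≡ just (entry f k)
  map-address f k<l rewrite address-< k<l = refl

  entry-updated : ∀ {l k} (f : Vector A l) (k<l : k ℕ.< l) {x} →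
                  entry (updateAt f (fromℕ< k<l) (const x)) k ≡ x
  entry-updated f k<l = ≡.trans (entry-fromℕ< _ k<l) (updateAt-updates (fromℕ< k<l) f)

  entry-minimal : ∀ {l k k′} (f : Vector A l) (k<l : k ℕ.< l) {x} → k′ ℕ.< l → k′ ≢ k →
                  entry (updateAt f (fromℕ< k<l) (const x)) k′ ≡ entry f k′
  entry-minimal f k<l k′<l k′≢k = begin
    entry (updateAt f (fromℕ< k<l) (const _)) _
      ≡⟨ entry-fromℕ< _ k′<l ⟩
    updateAt f (fromℕ< k<l) (const _) (fromℕ< k′<l)
      ≡⟨ updateAt-minimal _ _ f (k′≢k ∘ Fin.fromℕ<-injective _ _ k′<l k<l) ⟩
    f (fromℕ< k′<l)
      ≡⟨ entry-fromℕ< f k′<l ⟨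
    entry f _ ∎
    where open ≡-Reasoning

  entry-concat : ∀ {m d} (xss : Vector (Vector A d) m) i j →
                 entry (concat xss) (d ℕ.* toℕ i ℕ.+ toℕ j) ≡ xss i j
  entry-concat {d = d} xss i j = begin
    entry (concat xss) (d ℕ.* toℕ i ℕ.+ toℕ j)  ≡⟨ cong (entry (concat xss)) (Fin.toℕ-combine i j) ⟨
    entry (concat xss) (toℕ (combine i j))      ≡⟨ entry-toℕ (concat xss) (combine i j) ⟩
    concat xss (combine i j)                    ≡⟨ cong (uncurry xss) (Fin.remQuot-combine i j) ⟩
    xss i j                                     ∎
    where open ≡-Reasoning

-- A timed program logic for the real RAM

countdown : Var → Program → Command
-- Decrementing before the body makes the body see k - 1, ..., 0, so the counter itself serves as an
-- index.
countdown x body = while (lit 0 <ʷ var x) (x ≔ var x ⊖ lit 1 ∷ body)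

module Execution {c ℓ₁ ℓ₂} (R : Reals c ℓ₁ ℓ₂) (I : Machine.Inputs R) {S : ℕ} where

  open import Data.Nat.Base using (_+_; _*_; _≤_; _<_)
  open Reals R using (ℝ)
  open Machine R
  open Semantics I {S}
  open Entries (Reals.0# R)

  infixr 5 _◅_
  infix  4 _⇓[_]_

  -- The index bounds the number of steps from above.
  data _⇓[_]_ : Config S → ℕ → Config S → Set c where
    ε   : ∀ {κ t} → κ ⇓[ t ] κ
    _◅_ : ∀ {a K σ κ κ′ t} → step a K σ ≡ next κ → κ ⇓[ t ] κ′ → (a ∷ K , σ) ⇓[ suc t ] κ′

  ⇓-weaken : ∀ {κ κ′ t u} → t ≤ u → κ ⇓[ t ] κ′ → κ ⇓[ u ] κ′
  ⇓-weaken _         ε        = ε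
  ⇓-weaken (s≤s t≤u) (s ◅ κ⇓) = s ◅ ⇓-weaken t≤u κ⇓

  ⇓-trans : ∀ {κ κ′ κ″ t u} → κ ⇓[ t ] κ′ → κ′ ⇓[ u ] κ″ → κ ⇓[ t + u ] κ″
  ⇓-trans {t = t} {u} ε κ′⇓ = ⇓-weaken (ℕ.m≤n+m u t) κ′⇓
  ⇓-trans (s ◅ κ⇓) κ′⇓ = s ◅ ⇓-trans κ⇓ κ′⇓

  run-⇓ : ∀ {κ σ t} → κ ⇓[ t ] ([] , σ) → run t κ ≡ just σ
  run-⇓ ε = refl
  run-⇓ (s ◅ κ⇓) rewrite s = run-⇓ κ⇓

  -- The index of `_⇓[_]_` is only an upper bound, so the part of `T` left at `κ′` is not known
  -- exactly. The hypothesis therefore covers every allowance from `u` upwards.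
  probability-⇓ : ∀ {p} (P : Pred ℝ p) {i κ κ′ t u} → κ ⇓[ t ] κ′ →
                  (∀ {T} → u ≤ T → P (probability T κ′ i)) →
                  ∀ {T} → t + u ≤ T → P (probability T κ i)
  probability-⇓ P {t = t} {u} ε        h le = h (ℕ.≤-trans (ℕ.m≤n+m u t) le)
  probability-⇓ P (s ◅ κ⇓) h {suc T} (s≤s le) rewrite s = probability-⇓ P κ⇓ h le

  -- A total-correctness triple with a time bound. Quantifying over the continuation lets a fragment
  -- be verified once and then run in front of anything, such as the remaining rounds of its own
  -- loop.
  Runs : ∀ {q} → Program → State S → ℕ → Pred (State S) q → Set (c Level.⊔ q)
  Runs a σ t Q = ∀ K → ∃[ σ′ ] Q σ′ × (a ++ K , σ) ⇓[ t ] (K , σ′)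

  private variable
    p q : Level
    a b : Program
    σ : State S
    t u : ℕ

  runs-[] : {Q : Pred (State S) q} → Q σ → Runs [] σ t Q
  runs-[] qσ K = _ , qσ , ε

  runs-weaken : {Q : Pred (State S) q} → t ≤ u → Runs a σ t Q → Runs a σ u Q
  runs-weaken t≤u r K with r K
  ... | σ′ , qσ′ , κ⇓ = σ′ , qσ′ , ⇓-weaken t≤u κ⇓

  runs-map : {P : Pred (State S) p} {Q : Pred (State S) q} →
             (∀ {σ} → P σ → Q σ) → Runs a σ t P → Runs a σ t Q
  runs-map f r K with r K
  ... | σ′ , pσ′ , κ⇓ = σ′ , f pσ′ , κ⇓

  assign-step : ∀ x e {w K} → evalWord (env σ) e ≡ w → w ≤ S →
                step (x ≔ e) K σ ≡ next (K , ⟨ env σ [ x ↦ w ] , mem σ ⟩)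
  assign-step x e refl w≤S rewrite ≤ᵇ-true w≤S = refl

  runs-assign : {Q : Pred (State S) q} → ∀ {x e w} → evalWord (env σ) e ≡ w → w ≤ S →
                Runs b ⟨ env σ [ x ↦ w ] , mem σ ⟩ t Q → Runs (x ≔ e ∷ b) σ (suc t) Q
  runs-assign {x = x} {e} eq w≤S r K with r K
  ... | σ′ , qσ′ , κ⇓ = σ′ , qσ′ , assign-step x e eq w≤S ◅ κ⇓

  runs-store : {Q : Pred (State S) q} → ∀ {e k r x} → evalWord (env σ) e ≡ k → (k<S : k < S) →
               evalScalar σ r ≡ just x →
               Runs b ⟨ env σ , updateAt (mem σ) (fromℕ< k<S) (const x) ⟩ t Q →
               Runs (memory[ e ]≔ r ∷ b) σ (suc t) Q
  runs-store {σ = σ} {e = e} {r = r} {x} refl k<S eq h K with h K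
  ... | σ′ , qσ′ , κ⇓ = σ′ , qσ′ , stores ◅ κ⇓
    where
    stores : ∀ {K} → step (memory[ e ]≔ r) K σ ≡
             next (K , ⟨ env σ , updateAt (mem σ) (fromℕ< k<S) (const x) ⟩)
    stores rewrite address-< k<S | eq = refl

  runs-cond : {Q : Pred (State S) q} → ∀ {e x} → evalTest σ e ≡ just x →
              Runs (if x then a else b) σ t Q → Runs (cond e a b ∷ []) σ (suc t) Q
  runs-cond {x = true} eq r K with r K
  ... | σ′ , qσ′ , κ⇓ = σ′ , qσ′ , cong (λ y → choose y _ _ _) eq ◅ κ⇓
  runs-cond {x = false} eq r K with r K
  ... | σ′ , qσ′ , κ⇓ = σ′ , qσ′ , cong (λ y → choose y _ _ _) eq ◅ κ⇓

  -- Each round adds a test and a decrement to the body, and the failing last test costs one step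
  -- more. The counter has to stay within `S` because assigning a larger word faults.
  runs-countdown : ∀ x (Inv : ℕ → Pred (State S) q) →
    (∀ {k σ} → Inv k σ → env σ x ≡ k × k ≤ S) →
    (∀ {k σ} → Inv (suc k) σ → Runs a ⟨ env σ [ x ↦ k ] , mem σ ⟩ t (Inv k)) →
    ∀ {k} → Inv k σ → Runs (countdown x a ∷ []) σ (suc (k * (2 + t))) (Inv 0)
  runs-countdown {σ = σ} x Inv counter body {zero} inv K = σ , inv , exit ◅ ε
    where
    exit : ∀ {a} → step (countdown x a) K σ ≡ next (K , σ)
    exit rewrite proj₁ (counter inv) = refl
  runs-countdown {a = a} {t = t} {σ = σ} x Inv counter body {suc k} inv K
    with body inv (countdown x a ∷ K)
  ... | σ′ , inv′ , κ⇓ with runs-countdown x Inv counter body inv′ K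
  ... | σ″ , inv″ , κ′⇓ = σ″ , inv″ ,
    enter ◅ assign-step x (var x ⊖ lit 1) (cong (ℕ._∸ 1) (proj₁ (counter inv)))
      (ℕ.≤-trans (ℕ.n≤1+n k) (proj₂ (counter inv))) ◅
    ⇓-weaken (ℕ.≤-reflexive (ℕ.+-suc t _)) (⇓-trans κ⇓ κ′⇓)
    where
    enter : step (countdown x a) K σ ≡ next (x ≔ var x ⊖ lit 1 ∷ a ++ countdown x a ∷ K , σ)
    enter rewrite proj₁ (counter inv) = refl

-- Tree arithmetic on the machine and the preprocessing program

leftChildʷ rightChildʷ : Word → Word
leftChildʷ  j = j ⊕ j ⊕ lit 1
rightChildʷ j = j ⊕ j ⊕ lit 2

-- `nVar` holds the number of leaves, which exceeds the number of inner nodes by one; hence the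
-- added 1.
isInner : Word → Test
isInner j = j ⊕ lit 1 <ʷ var nVar

leafIndex : Word → Word
leafIndex j = j ⊕ lit 1 ⊖ var nVar

matrixEntry : Word → Word → Word
matrixEntry j e = var dVar ⊗ var dVar ⊗ j ⊕ e

module Init where

  jVar aVar bVar : Var
  jVar = 3
  aVar = 4
  bVar = 5

  cell : Word → Word
  cell j = matrixEntry j (var dVar ⊗ var aVar ⊕ var bVar)

  inner leaf : Scalar
  inner = memory [ cell (leftChildʷ (var jVar)) ] ⊞ memory [ cell (rightChildʷ (var jVar)) ]
  leaf  = input₂ [ i ] ⊠ (input₁ [ var dVar ⊗ i ⊕ var aVar ] ⊠ input₁ [ var dVar ⊗ i ⊕ var bVar ])
    where i = leafIndex (var jVar)

  writeInner writeLeaf innerBody middleBody outerBody init : Program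
  writeInner = memory[ cell (var jVar) ]≔ inner ∷ []
  writeLeaf  = memory[ cell (var jVar) ]≔ leaf ∷ []
  innerBody  = cond (isInner (var jVar)) writeInner writeLeaf ∷ []
  middleBody = bVar ≔ var dVar ∷ countdown bVar innerBody ∷ []
  outerBody  = aVar ≔ var dVar ∷ countdown aVar middleBody ∷ []
  init       = jVar ≔ var nVar ⊕ var nVar ⊖ lit 1 ∷ countdown jVar outerBody ∷ []

-- Correctness and cost of preprocessing

module Preprocessing {c ℓ₁ ℓ₂} (R : Reals c ℓ₁ ℓ₂) {n d : ℕ} .{{_ : NonZero d}}
  (v : Vector (Vector (Reals.ℝ R) d) (suc n)) (α : Vector (Reals.ℝ R) (suc n)) where

  open import Data.Nat.Base using (_+_; _*_; _∸_; _≤_; _<_)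
  open Reals R using (ℝ) renaming (_+_ to _+ʳ_; _*_ to _*ʳ_)
  open Heaps R
  open Machine R
  open QuadraticFormSampling R using (Preprocesses)
  open Entries (Reals.0# R)
  open Init

  nodes D S : ℕ
  nodes = suc (n + n)
  D     = d * d
  S     = 2 * (suc n * D)

  open Semantics (inputs (concat v) α) {S}
  open Execution R (inputs (concat v) α) {S}

  -- The (a , b) entry of the sum of αᵢ vᵢ vᵢᵀ over the leaves i below a node.
  nodeMatrix : ℕ → ℕ → ℕ → ℝ
  nodeMatrix a b = fromLeaves n λ i →
    entry α i *ʳ (entry (concat v) (d * i + a) *ʳ entry (concat v) (d * i + b))

  address-of : ℕ → ℕ → ℕ → ℕ
  address-of j a b = D * j + (d * a + b)

  D-positive : 1 ≤ D
  D-positive = ℕ.*-mono-≤ (ℕ.>-nonZero⁻¹ d) (ℕ.>-nonZero⁻¹ d)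

  nodes≤2n : nodes ≤ 2 * suc n
  nodes≤2n = ℕ.≤-trans (ℕ.n≤1+n nodes) (ℕ.≤-reflexive (lemma n))
    where
    lemma : ∀ n → suc (suc (n + n)) ≡ 2 * suc n
    lemma = solve-∀

  D*nodes≤S : D * nodes ≤ S
  D*nodes≤S = begin
    D * nodes         ≤⟨ ℕ.*-monoʳ-≤ D nodes≤2n ⟩
    D * (2 * suc n)   ≡⟨ lemma D (suc n) ⟩
    2 * (suc n * D)   ∎
    where
    open ℕ.≤-Reasoning
    lemma : ∀ D n → D * (2 * n) ≡ 2 * (n * D)
    lemma = solve-∀

  nodes≤S : nodes ≤ S
  nodes≤S = begin
    nodes      ≡⟨ ℕ.*-identityˡ nodes ⟨
    1 * nodes  ≤⟨ ℕ.*-monoˡ-≤ nodes D-positive ⟩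
    D * nodes  ≤⟨ D*nodes≤S ⟩
    S          ∎
    where open ℕ.≤-Reasoning

  D≤S : D ≤ S
  D≤S = ℕ.≤-trans (ℕ.m≤m*n D nodes) D*nodes≤S

  d≤S : d ≤ S
  d≤S = ℕ.≤-trans (ℕ.m≤m*n d d) D≤S

  address-<-nodes : ∀ {j a b} → j < nodes → a < d → b < d → address-of j a b < D * nodes
  address-<-nodes j< a< b< = digits-< j< (digits-< a< b<)

  address-<S : ∀ {j a b} → j < nodes → a < d → b < d → address-of j a b < S
  address-<S j< a< b< = ℕ.<-≤-trans (address-<-nodes j< a< b<) D*nodes≤S

  -- All loops of init count down, so the cells are written from the highest
  -- address downwards and children precede their parents.
  Filled : ℕ → Pred (Vector ℝ S) c
  Filled k m = ∀ {j a b} → j < nodes → a < d → b < d → k ≤ address-of j a b →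
               entry m (address-of j a b) ≡ nodeMatrix a b j

  module _ {j a b : ℕ} (j< : j < nodes) (a< : a < d) (b< : b < d) where

    private k = address-of j a b

    -- An address determines node, row and column, so the overwritten cell is precisely the one that
    -- lowering the bound from `suc k` to `k` newly demands.
    filled-step : ∀ {m} → Filled (suc k) m → ∀ {x} → x ≡ nodeMatrix a b j →
                  Filled k (updateAt m (fromℕ< (address-<S j< a< b<)) (const x))
    filled-step {m} filled x≡ {j′} {a′} {b′} j′< a′< b′< k≤ with k ℕ.≟ address-of j′ a′ b′
    ... | no k≢ = ≡.trans
      (entry-minimal m (address-<S j< a< b<) (address-<S j′< a′< b′<) (k≢ ∘ ≡.sym))
      (filled j′< a′< b′< (ℕ.≤∧≢⇒< k≤ k≢))
    ... | yes k≡ with digits-injective j j′ (digits-< a< b<) (digits-< a′< b′<) k≡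
    ... | refl , ab≡ with digits-injective a a′ b< b′< ab≡
    ... | refl , refl = ≡.trans (entry-updated m (address-<S j< a< b<)) x≡

    leaf-value : n ≤ j → nodeMatrix a b j ≡ entry α (j ∸ n) *ʳ
      (entry (concat v) (d * (j ∸ n) + a) *ʳ entry (concat v) (d * (j ∸ n) + b))
    leaf-value n≤j = fromLeaves-leaf n _ n≤j

    inner-value : ∀ {m} → Filled (suc k) m → j < n →
                  entry m (address-of (leftChild j) a b) +ʳ entry m (address-of (rightChild j) a b)
                  ≡ nodeMatrix a b j
    inner-value filled j<n = ≡.trans
      (cong₂ _+ʳ_ (filled (s≤s (leftChild-≤ j<n)) a< b< (below (node<leftChild j)))
                  (filled (s≤s (rightChild-≤ j<n)) a< b< (below (node<rightChild j))))
      (≡.sym (fromLeaves-inner n _ j<n))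
      where
      below : ∀ {j′} → j < j′ → k < address-of j′ a b
      below {j′} j<j′ = ℕ.+-monoˡ-< (d * a + b) (ℕ.*-monoʳ-< D {{ℕ.>-nonZero D-positive}} j<j′)

  record Outer (j : ℕ) (σ : State S) : Set c where
    field
      n≡     : env σ nVar ≡ suc n
      d≡     : env σ dVar ≡ d
      j≡     : env σ jVar ≡ j
      j≤     : j ≤ nodes
      filled : Filled (D * j) (mem σ)

  record Middle (j a : ℕ) (σ : State S) : Set c where
    field
      n≡     : env σ nVar ≡ suc n
      d≡     : env σ dVar ≡ d
      j≡     : env σ jVar ≡ j
      a≡     : env σ aVar ≡ a
      j<     : j < nodes
      a≤     : a ≤ d
      filled : Filled (D * j + d * a) (mem σ)

  record Inner (j a b : ℕ) (σ : State S) : Set c where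
    field
      n≡     : env σ nVar ≡ suc n
      d≡     : env σ dVar ≡ d
      j≡     : env σ jVar ≡ j
      a≡     : env σ aVar ≡ a
      b≡     : env σ bVar ≡ b
      j<     : j < nodes
      a<     : a < d
      b≤     : b ≤ d
      filled : Filled (address-of j a b) (mem σ)

  inner-body : ∀ {j a b σ} → Inner j a (suc b) σ →
               Runs innerBody ⟨ env σ [ bVar ↦ b ] , mem σ ⟩ 2 (Inner j a b)
  inner-body {j} {a} {b} {σ} inv =
    runs-cond {e = isInner (var jVar)} isInner≡ (branches (suc j ℕ.<ᵇ suc n) refl)
    where
    open Inner inv
    ρ : Env
    ρ = env σ [ bVar ↦ b ]

    σ′ : State S
    σ′ = ⟨ ρ , mem σ ⟩

    b< : b < d
    b< = b≤

    filled′ : Filled (suc (address-of j a b)) (mem σ)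
    filled′ = subst (λ k → Filled k (mem σ))
      (≡.trans (cong (D * j +_) (ℕ.+-suc (d * a) b)) (ℕ.+-suc (D * j) _)) filled

    cell≡ : ∀ {w} → evalWord ρ (cell w) ≡ address-of (evalWord ρ w) a b
    cell≡ rewrite d≡ | a≡ = refl

    leftChild≡ʷ : evalWord ρ (leftChildʷ (var jVar)) ≡ leftChild j
    leftChild≡ʷ = cong leftChild j≡

    rightChild≡ʷ : evalWord ρ (rightChildʷ (var jVar)) ≡ rightChild j
    rightChild≡ʷ = cong rightChild j≡

    isInner≡ : evalTest σ′ (isInner (var jVar)) ≡ just (suc j ℕ.<ᵇ suc n)
    isInner≡ rewrite n≡ | j≡ | ℕ.+-comm j 1 = refl

    writes : ∀ {r x} → evalScalar σ′ r ≡ just x → x ≡ nodeMatrix a b j →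
             Runs (memory[ cell (var jVar) ]≔ r ∷ []) σ′ 1 (Inner j a b)
    writes {r} eq x≡ = runs-store {e = cell (var jVar)} {r = r}
      (≡.trans (cell≡ {var jVar}) (cong (λ j → address-of j a b) j≡))
      (address-<S j< a< b<) eq (runs-[] record
      { n≡ = n≡ ; d≡ = d≡ ; j≡ = j≡ ; a≡ = a≡ ; b≡ = refl ; j< = j< ; a< = a< ; b≤ = ℕ.<⇒≤ b<
      ; filled = filled-step j< a< b< filled′ x≡ })

    reads : ∀ {w j′} → evalWord ρ w ≡ j′ → j′ < nodes →
            evalScalar σ′ (memory [ cell w ]) ≡ just (entry (mem σ) (address-of j′ a b))
    reads {w} refl j′< rewrite cell≡ {w} = map-address (mem σ) (address-<S j′< a< b<)

    branches : ∀ x → (suc j ℕ.<ᵇ suc n) ≡ x →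
               Runs (if x then writeInner else writeLeaf) σ′ 1 (Inner j a b)
    branches true eq = writes {inner}
      (cong₂ (Maybe.zipWith _+ʳ_)
        (reads {leftChildʷ (var jVar)} leftChild≡ʷ (s≤s (leftChild-≤ j<n)))
        (reads {rightChildʷ (var jVar)} rightChild≡ʷ (s≤s (rightChild-≤ j<n))))
      (inner-value j< a< b< filled′ j<n)
      where
      j<n : j < n
      j<n = ℕ.<ᵇ⇒< j n (subst T (≡.sym eq) _)
    branches false eq = writes {leaf}
      (cong₂ (Maybe.zipWith _*ʳ_) (read₂ {i} i≡)
        (cong₂ (Maybe.zipWith _*ʳ_) (read₁ {i} {aVar} i≡ a≡ a<) (read₁ {i} {bVar} i≡ refl b<)))
      (≡.sym (leaf-value j< a< b< n≤j))
      where
      i : Word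
      i = leafIndex (var jVar)

      n≤j : n ≤ j
      n≤j = ℕ.≮⇒≥ λ j<n → contradiction (≡.trans (≡.sym eq) (<ᵇ-true j<n)) λ ()

      i< : j ∸ n < suc n
      i< = s≤s (ℕ.≤-trans (ℕ.∸-monoˡ-≤ n (ℕ.≤-pred j<)) (ℕ.≤-reflexive (ℕ.m+n∸n≡m n n)))

      i≡ : evalWord ρ (leafIndex (var jVar)) ≡ j ∸ n
      i≡ rewrite n≡ | j≡ | ℕ.+-comm j 1 = refl

      read₂ : ∀ {w} → evalWord ρ w ≡ j ∸ n → evalScalar σ′ (input₂ [ w ]) ≡ just (entry α (j ∸ n))
      read₂ eq rewrite eq = map-address α i<

      read₁ : ∀ {w x y} → evalWord ρ w ≡ j ∸ n → evalWord ρ (var x) ≡ y → y < d →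
              evalScalar σ′ (input₁ [ var dVar ⊗ w ⊕ var x ]) ≡
              just (entry (concat v) (d * (j ∸ n) + y))
      read₁ {y = y} eq refl y< rewrite eq | d≡ = map-address (concat v)
        (subst (d * (j ∸ n) + y <_) (ℕ.*-comm d (suc n)) (digits-< i< y<))

  middle-body : ∀ {j a σ} → Middle j (suc a) σ →
                Runs middleBody ⟨ env σ [ aVar ↦ a ] , mem σ ⟩ (2 + d * 4) (Middle j a)
  middle-body {j} {a} {σ} inv = runs-assign {e = var dVar} d≡ d≤S (runs-map leave
    (runs-countdown bVar (Inner j a) (λ i → Inner.b≡ i , ℕ.≤-trans (Inner.b≤ i) d≤S)
      inner-body enter))
    where
    open Middle inv
    enter : Inner j a d ⟨ (env σ [ aVar ↦ a ]) [ bVar ↦ d ] , mem σ ⟩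
    enter = record
      { n≡ = n≡ ; d≡ = d≡ ; j≡ = j≡ ; a≡ = refl ; b≡ = refl ; j< = j< ; a< = a≤ ; b≤ = ℕ.≤-refl
      ; filled = subst (λ k → Filled (D * j + k) (mem σ))
                   (≡.trans (ℕ.*-suc d a) (ℕ.+-comm d (d * a))) filled }
    leave : ∀ {σ} → Inner j a 0 σ → Middle j a σ
    leave {σ} i = record
      { n≡ = I.n≡ ; d≡ = I.d≡ ; j≡ = I.j≡ ; a≡ = I.a≡ ; j< = j< ; a≤ = ℕ.<⇒≤ a≤
      ; filled = subst (λ k → Filled (D * j + k) (mem σ)) (ℕ.+-identityʳ (d * a)) I.filled }
      where module I = Inner i

  outer-body : ∀ {j σ} → Outer (suc j) σ →
               Runs outerBody ⟨ env σ [ jVar ↦ j ] , mem σ ⟩ (2 + d * (4 + d * 4)) (Outer j)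
  outer-body {j} {σ} inv = runs-assign {e = var dVar} d≡ d≤S (runs-map leave
    (runs-countdown aVar (Middle j) (λ i → Middle.a≡ i , ℕ.≤-trans (Middle.a≤ i) d≤S)
      middle-body enter))
    where
    open Outer inv
    enter : Middle j d ⟨ (env σ [ jVar ↦ j ]) [ aVar ↦ d ] , mem σ ⟩
    enter = record
      { n≡ = n≡ ; d≡ = d≡ ; j≡ = refl ; a≡ = refl ; j< = j≤ ; a≤ = ℕ.≤-refl
      ; filled = subst (λ k → Filled k (mem σ)) (≡.trans (ℕ.*-suc D j) (ℕ.+-comm D (D * j))) filled }
    leave : ∀ {σ} → Middle j 0 σ → Outer j σ
    leave {σ} i = record
      { n≡ = I.n≡ ; d≡ = I.d≡ ; j≡ = I.j≡ ; j≤ = ℕ.<⇒≤ j≤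
      ; filled = subst (λ k → Filled k (mem σ))
                   (≡.trans (cong (D * j +_) (ℕ.*-zeroʳ d)) (ℕ.+-identityʳ (D * j))) I.filled }
      where module I = Middle i

  -- Each of the three nested loops contributes a cost of 4 at its level, and there are at most two
  -- nodes per vector. With the two steps outside the loops this gives 26 = 2 + 2 (4 + 4 + 4).
  preprocess-time : suc (suc (nodes * (4 + d * (4 + d * 4)))) ≤ 26 * (suc n * D)
  preprocess-time = begin
    2 + nodes * (4 + d * (4 + d * 4))
      ≡⟨ lemma₁ nodes d ⟩
    2 + nodes * (4 * 1 + 4 * d + 4 * D)
      ≤⟨ ℕ.+-mono-≤ (ℕ.*-monoʳ-≤ 2 1≤N) (ℕ.*-mono-≤ nodes≤2n (ℕ.+-monoˡ-≤ (4 * D)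
          (ℕ.+-mono-≤ (ℕ.*-monoʳ-≤ 4 D-positive) (ℕ.*-monoʳ-≤ 4 (ℕ.m≤m*n d d))))) ⟩
    2 * (suc n * D) + 2 * suc n * (4 * D + 4 * D + 4 * D)
      ≡⟨ lemma₂ (suc n) D ⟩
    26 * (suc n * D) ∎
    where
    open ℕ.≤-Reasoning
    1≤N : 1 ≤ suc n * D
    1≤N = ℕ.*-mono-≤ (s≤s (z≤n {n})) D-positive
    lemma₁ : ∀ k d → 2 + k * (4 + d * (4 + d * 4)) ≡ 2 + k * (4 * 1 + 4 * d + 4 * (d * d))
    lemma₁ = solve-∀
    lemma₂ : ∀ n D → 2 * (n * D) + 2 * n * (4 * D + 4 * D + 4 * D) ≡ 26 * (n * D)
    lemma₂ = solve-∀

  init-runs : ∀ m → Runs init ⟨ initialEnv (suc n) d , m ⟩ (26 * (suc n * D)) (Outer 0)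
  init-runs m = runs-weaken preprocess-time
    (runs-assign {e = var nVar ⊕ var nVar ⊖ lit 1} (ℕ.+-suc n n) nodes≤S
      (runs-countdown jVar Outer (λ i → Outer.j≡ i , ℕ.≤-trans (Outer.j≤ i) nodes≤S)
        outer-body start))
    where
    start : Outer nodes ⟨ initialEnv (suc n) d [ jVar ↦ nodes ] , m ⟩
    start = record
      { n≡ = refl ; d≡ = refl ; j≡ = refl ; j≤ = ℕ.≤-refl
      -- Vacuous at the start, since every cell in use lies below `D * nodes`; the initial memory
      -- contents may thus be arbitrary.
      ; filled = λ j< a< b< k≤ → contradiction (address-<-nodes j< a< b<) (ℕ.≤⇒≯ k≤) }

  preprocess : ∀ m → ∃[ σ ] Filled 0 (mem σ) × Preprocesses init (26 * (suc n * D)) v α m σ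
  preprocess m =
    let σ , outer , σ⇓ = init-runs m []
    in σ , subst (λ k → Filled k (mem σ)) (ℕ.*-zeroʳ D) (Outer.filled outer) , run-⇓ σ⇓

-- The query program

module Query where

  eVar : Var
  eVar = 3

  descend : Word → Program
  descend child = resultVar ≔ child ∷ []

  -- The input matrix and the stored matrices are all laid out row by row, so the Frobenius product
  -- is a dot product under a single index.
  accumulated : ℕ → Word → Scalar
  accumulated k j =
    memory [ lit k ] ⊞ input₁ [ var eVar ] ⊠ input₂ [ matrixEntry j (var eVar) ]

  accumulate : ℕ → Word → Command
  accumulate k j = memory[ lit k ]≔ accumulated k j

  -- Cell 0 holds the mass of the current node and cell 1 that of its left child. The right child is
  -- reached with the complementary probability and is not measured.
  quotient : Scalar
  quotient = memory [ lit 1 ] ⊘ memory [ lit 0 ]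

  branching : Command
  branching = flip quotient
    (descend (leftChildʷ (var resultVar))) (descend (rightChildʷ (var resultVar)))

  accumulateBoth measure queryBody query : Program
  accumulateBoth =
    accumulate 0 (var resultVar) ∷ accumulate 1 (leftChildʷ (var resultVar)) ∷ []
  measure =
    memory[ lit 0 ]≔ zeroˢ ∷ memory[ lit 1 ]≔ zeroˢ ∷
    eVar ≔ var dVar ⊗ var dVar ∷ countdown eVar accumulateBoth ∷ []
  queryBody = measure ++ branching ∷ []
  -- `resultVar` is 0 on entry, which is already the root. After a flip and the move to a child the
  -- remaining program is again `query`, so correctness can be proved by induction on the walk.
  query =
    while (isInner (var resultVar)) queryBody ∷
    resultVar ≔ leafIndex (var resultVar) ∷ []

-- Masses of subtrees and the target distribution

module Masses {c ℓ₁ ℓ₂} (R : Reals c ℓ₁ ℓ₂) {n d : ℕ} .{{_ : NonZero d}}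
  (v : Vector (Vector (Reals.ℝ R) d) (suc n)) (α : Vector (Reals.ℝ R) (suc n))
  (m : Vector (Reals.ℝ R) (Preprocessing.S R v α)) (filled : Preprocessing.Filled R v α 0 m)
  (A : QuadraticFormSampling.Matrix R d) (dist : QuadraticFormSampling.IsDistribution R v α A) where

  open Reals R
    renaming (refl to ≈-refl; sym to ≈-sym; trans to ≈-trans; reflexive to ≈-reflexive)
  open Sum semiring using (sum; sum-cong-≋; *-distribˡ-sum)
  open CommutativeSemigroupProperties *-commutativeSemigroup using (x∙yz≈y∙xz)
  open QuadraticFormSampling R
  open Entries 0#
  open Order R
  open FiniteSums R
  open Heaps R
  open Preprocessing R v α using (nodeMatrix; nodes; D)
  open import Relation.Binary.Reasoning.Setoid setoid

  mass : ℕ → ℝ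
  mass j = Σ< D λ e → entry (concat A) e * entry m (D ℕ.* j ℕ.+ e)

  private
    entryA : ℕ → ℕ → ℝ
    entryA a b = entry (concat A) (d ℕ.* a ℕ.+ b)

  mass≈ : ∀ {j} → j ℕ.< nodes → mass j ≈ Σ< d λ a → Σ< d λ b → entryA a b * nodeMatrix a b j
  mass≈ {j} j< = ≈-trans (Σ<-digits d d _) (Σ<-cong d λ a< → Σ<-cong d λ b< →
    *-congˡ (≈-reflexive (filled j< a< b< z≤n)))

  -- The stored matrices add up over children, and the Frobenius product with A is linear in its
  -- other factor.
  mass-isHeap : IsHeap n mass
  mass-isHeap {j} j<n = begin
    mass j
      ≈⟨ mass≈ (s≤s (ℕ.≤-trans (ℕ.<⇒≤ j<n) (ℕ.m≤m+n n n))) ⟩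
    (Σ< d λ a → Σ< d λ b → entryA a b * nodeMatrix a b j)
      ≈⟨ (Σ<-cong d λ {a} _ → Σ<-cong d λ {b} _ →
          ≈-trans (*-congˡ (fromLeaves-isHeap n _ j<n)) (distribˡ (entryA a b) _ _)) ⟩
    (Σ< d λ a → Σ< d λ b → L a b + R′ a b)
      ≈⟨ Σ<-cong d (λ {a} _ → Σ<-+ d (L a) (R′ a)) ⟩
    (Σ< d λ a → Σ< d (L a) + Σ< d (R′ a))
      ≈⟨ Σ<-+ d _ _ ⟩
    (Σ< d λ a → Σ< d (L a)) + (Σ< d λ a → Σ< d (R′ a))
      ≈⟨ +-cong (mass≈ (s≤s (leftChild-≤ j<n))) (mass≈ (s≤s (rightChild-≤ j<n))) ⟨
    mass (leftChild j) + mass (rightChild j) ∎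
    where
    L R′ : ℕ → ℕ → ℝ
    L  a b = entryA a b * nodeMatrix a b (leftChild j)
    R′ a b = entryA a b * nodeMatrix a b (rightChild j)

  -- The Frobenius product of A with vᵢ vᵢᵀ is the quadratic form of A at vᵢ.
  mass-leaf : ∀ i → mass (n ℕ.+ toℕ i) ≈ weight v α A i
  mass-leaf i = begin
    mass (n ℕ.+ toℕ i)
      ≈⟨ mass≈ (s≤s (ℕ.+-monoʳ-≤ n (Fin.toℕ≤pred[n] i))) ⟩
    (Σ< d λ a → Σ< d λ b → entryA a b * nodeMatrix a b (n ℕ.+ toℕ i))
      ≈⟨ (Σ<≈sum λ a → Σ<≈sum λ b → *-cong (≈-reflexive (entry-concat A a b)) (leaf a b)) ⟩
    (sum λ a → sum λ b → A a b * (α i * (v i a * v i b)))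
      ≈⟨ (sum-cong-≋ λ a → sum-cong-≋ λ b → rearrange (A a b) (α i) (v i a) (v i b)) ⟩
    (sum λ a → sum λ b → α i * (v i a * A a b * v i b))
      ≈⟨ (sum-cong-≋ λ a → *-distribˡ-sum (α i) λ b → v i a * A a b * v i b) ⟨
    (sum λ a → α i * sum λ b → v i a * A a b * v i b)
      ≈⟨ (*-distribˡ-sum (α i) λ a → sum λ b → v i a * A a b * v i b) ⟨
    weight v α A i ∎
    where
    rearrange : ∀ x y z w → x * (y * (z * w)) ≈ y * (z * x * w)
    rearrange x y z w = ≈-trans (x∙yz≈y∙xz x y (z * w))
      (*-congˡ (≈-trans (x∙yz≈y∙xz x z w) (≈-sym (*-assoc z x w))))
    leaf : ∀ a b → nodeMatrix (toℕ a) (toℕ b) (n ℕ.+ toℕ i) ≈ α i * (v i a * v i b)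
    leaf a b
      rewrite fromLeaves-leaf n
                (λ k → entry α k *
                  (entry (concat v) (d ℕ.* k ℕ.+ toℕ a) * entry (concat v) (d ℕ.* k ℕ.+ toℕ b)))
                (ℕ.m≤m+n n (toℕ i))
            | ℕ.m+n∸m≡n n (toℕ i) | entry-toℕ α i | entry-concat v i a | entry-concat v i b
      = ≈-refl

  total⁻¹ : ℝ
  total⁻¹ = sum (weight v α A) ⁻¹

  mass-root : mass 0 * total⁻¹ ≈ 1#
  mass-root = ≈-trans
    (*-congʳ (≈-trans (heap-root mass-isHeap ℕ.≤-refl) (Σ<≈sum mass-leaf)))
    (⁻¹-inverseʳ (proj₁ dist))

  -- The probability that a sample lies below a node.
  below : ℕ → ℝ
  below j = mass j * total⁻¹

  below-isHeap : IsHeap n below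
  below-isHeap j<n = ≈-trans (*-congʳ (mass-isHeap j<n)) (distribʳ total⁻¹ _ _)

  below-leaf : ∀ i → below (n ℕ.+ toℕ i) ≈ 𝒟 v α A i
  below-leaf i = *-congʳ (mass-leaf i)

  below-leaf-nonneg : ∀ {k} → k ℕ.≤ n → 0# ≤ below (n ℕ.+ k)
  below-leaf-nonneg {k} k≤n = subst (λ k → 0# ≤ below (n ℕ.+ k)) (Fin.toℕ-fromℕ< (s≤s k≤n))
    (≤-respʳ-≈ (≈-sym (below-leaf (fromℕ< (s≤s k≤n)))) (proj₂ dist (fromℕ< (s≤s k≤n))))

  below-nonneg : ∀ {j} → j ℕ.≤ n ℕ.+ n → 0# ≤ below j
  below-nonneg = heap-mono 0-isHeap below-isHeap below-leaf-nonneg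

  below≉0⇒mass≉0 : ∀ {j} → ¬ (below j ≈ 0#) → ¬ (mass j ≈ 0#)
  below≉0⇒mass≉0 below≉0 mass≈0 = below≉0 (≈-trans (*-congʳ mass≈0) (zeroˡ _))

  -- The probability that a sample lies below a node and equals i.
  belowAt : ℕ → ℕ → ℝ
  belowAt i = fromLeaves n λ k → indicator i k * below (n ℕ.+ k)

  belowAt-isHeap : ∀ i → IsHeap n (belowAt i)
  belowAt-isHeap i = fromLeaves-isHeap n _

  belowAt-leaf : ∀ i {j} → n ℕ.≤ j → belowAt i j ≡ indicator i (j ℕ.∸ n) * below j
  belowAt-leaf i {j} n≤j = ≡.trans (fromLeaves-leaf n _ n≤j)
    (cong (λ k → indicator i (j ℕ.∸ n) * below k) (ℕ.m+[n∸m]≡n n≤j))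

  belowAt-leaf-bounds : ∀ i {k} → k ℕ.≤ n →
                        0# ≤ belowAt i (n ℕ.+ k) × belowAt i (n ℕ.+ k) ≤ below (n ℕ.+ k)
  belowAt-leaf-bounds i {k} k≤n rewrite belowAt-leaf i (ℕ.m≤m+n n k) with (n ℕ.+ k ℕ.∸ n) ℕ.≡ᵇ i
  ... | true  = ≤-respʳ-≈ (≈-sym (*-identityˡ _)) (below-leaf-nonneg k≤n) , inj₂ (*-identityˡ _)
  ... | false = inj₂ (≈-sym (zeroˡ _)) , ≤-respˡ-≈ (≈-sym (zeroˡ _)) (below-leaf-nonneg k≤n)

  -- `belowAt i` lies between zero and `below` at the leaves, hence at all nodes. This settles the
  -- nodes at which the program would divide by zero.
  below≈0⇒belowAt≈0 : ∀ i {j} → j ℕ.≤ n ℕ.+ n → below j ≈ 0# → belowAt i j ≈ 0#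
  below≈0⇒belowAt≈0 i j≤ below≈0 = antisym-0
    (heap-mono 0-isHeap (belowAt-isHeap i) (proj₁ ∘ belowAt-leaf-bounds i) j≤)
    (≤-respʳ-≈ below≈0
      (heap-mono (belowAt-isHeap i) below-isHeap (proj₂ ∘ belowAt-leaf-bounds i) j≤))

  belowAt-root : ∀ i → belowAt (toℕ i) 0 ≈ 𝒟 v α A i
  belowAt-root i = begin
    belowAt (toℕ i) 0
      ≈⟨ heap-root (belowAt-isHeap (toℕ i)) ℕ.≤-refl ⟩
    Σ< (suc n) (λ k → belowAt (toℕ i) (n ℕ.+ k))
      ≈⟨ Σ<-cong (suc n) (λ {k} _ → ≈-reflexive (leaf k)) ⟩
    Σ< (suc n) (λ k → indicator (toℕ i) k * below (n ℕ.+ k))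
      ≈⟨ Σ<-indicator (λ k → below (n ℕ.+ k)) (Fin.toℕ<n i) ⟩
    below (n ℕ.+ toℕ i)
      ≈⟨ below-leaf i ⟩
    𝒟 v α A i ∎
    where
    leaf : ∀ k → belowAt (toℕ i) (n ℕ.+ k) ≡ indicator (toℕ i) k * below (n ℕ.+ k)
    leaf k = ≡.trans (belowAt-leaf (toℕ i) (ℕ.m≤m+n n k))
      (cong (λ k′ → indicator (toℕ i) k′ * below (n ℕ.+ k)) (ℕ.m+n∸m≡n n k))

-- Correctness and cost of a query

module Querying {c ℓ₁ ℓ₂} (R : Reals c ℓ₁ ℓ₂) {n d : ℕ} .{{_ : NonZero d}}
  (v : Vector (Vector (Reals.ℝ R) d) (suc n)) (α : Vector (Reals.ℝ R) (suc n))
  (sums : Vector (Reals.ℝ R) (Preprocessing.S R v α)) (filled : Preprocessing.Filled R v α 0 sums)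
  (A : QuadraticFormSampling.Matrix R d) (dist : QuadraticFormSampling.IsDistribution R v α A) where

  open import Data.Nat.Base using (_+_; _*_; _∸_; _^_; _⊔_; _≤_; _<_)
  open Reals R using
    ( ℝ; _≈_; 0#; 1#; _≟_; _<?_; +-cong; +-congˡ; +-congʳ; +-assoc; +-comm
    ; +-identityˡ; +-identityʳ; *-congˡ; *-congʳ; *-identityʳ; zeroʳ)
    renaming ( _+_ to _+ʳ_; _*_ to _*ʳ_; _<_ to _<ʳ_; _≤_ to _≤ʳ_; _⁻¹ to _⁻¹ʳ
             ; refl to ≈-refl; sym to ≈-sym; trans to ≈-trans; reflexive to ≈-reflexive)
  open QuadraticFormSampling R using (Samples)
  open Order R
  open FieldIdentities R
  open FiniteSums R
  open Preprocessing R v α using (nodes; D; S; D-positive; D≤S; nodes≤S; D*nodes≤S)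
  open Masses R v α sums filled A dist
  open Machine R
  open Entries 0#
  open Query
  open Semantics (inputs (concat A) sums) {S}
  open Execution R (inputs (concat A) sums) {S}

  1<S : 1 < S
  1<S = ℕ.*-mono-≤ (ℕ.≤-refl {2}) (ℕ.*-mono-≤ (s≤s (z≤n {n})) D-positive)

  0<S : 0 < S
  0<S = ℕ.<-trans (s≤s z≤n) 1<S

  term : ℕ → ℕ → ℝ
  term j e = entry (concat A) e *ʳ entry sums (D * j + e)

  record AtNode (j : ℕ) (σ : State S) : Set where
    field
      n≡ : env σ nVar ≡ suc n
      d≡ : env σ dVar ≡ d
      j≡ : env σ resultVar ≡ j

  -- As the loop counts down, the terms with index at least e have been added. Stating accumulated
  -- plus outstanding keeps the sum an initial segment, whose last term is the next one to move
  -- across.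
  record Accumulating (j e : ℕ) (σ : State S) : Set ℓ₁ where
    field
      at-node : AtNode j σ
      e≡      : env σ eVar ≡ e
      e≤      : e ≤ D
      acc₀    : entry (mem σ) 0 +ʳ Σ< e (term j) ≈ mass j
      acc₁    : entry (mem σ) 1 +ʳ Σ< e (term (leftChild j)) ≈ mass (leftChild j)

  record Measured (j : ℕ) (σ : State S) : Set ℓ₁ where
    field
      at-node : AtNode j σ
      mass₀   : entry (mem σ) 0 ≈ mass j
      mass₁   : entry (mem σ) 1 ≈ mass (leftChild j)

  evaluate-accumulate : ∀ {σ k e j w} → k < S → env σ dVar ≡ d → env σ eVar ≡ e →
    evalWord (env σ) w ≡ j → e < D → j < nodes →
    evalScalar σ (accumulated k w) ≡ just (entry (mem σ) k +ʳ term j e)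
  evaluate-accumulate {σ} {w = w} k<S d≡ refl refl e<D j<
    rewrite d≡ | map-address (mem σ) k<S | map-address (concat A) e<D
          | map-address sums (ℕ.<-≤-trans (digits-< j< e<D) D*nodes≤S) = refl

  accumulate-step : ∀ {j e σ} → j < n → Accumulating j (suc e) σ →
    Runs accumulateBoth ⟨ env σ [ eVar ↦ e ] , mem σ ⟩ 2 (Accumulating j e)
  accumulate-step {j} {e} {σ} j<n inv =
    runs-store {e = lit 0} {r = accumulated 0 (var resultVar)} refl 0<S
      (evaluate-accumulate {σ₀} {w = var resultVar} 0<S d≡ refl j≡ e≤
        (s≤s (ℕ.≤-trans (ℕ.<⇒≤ j<n) (ℕ.m≤m+n n n))))
    (runs-store {e = lit 1} {r = accumulated 1 (leftChildʷ (var resultVar))} refl 1<S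
      (evaluate-accumulate {σ₁} {w = leftChildʷ (var resultVar)} 1<S d≡ refl (cong leftChild j≡) e≤
        (s≤s (leftChild-≤ j<n)))
    (runs-[] record
      { at-node = record { n≡ = n≡ ; d≡ = d≡ ; j≡ = j≡ }
      ; e≡ = refl
      ; e≤ = ℕ.<⇒≤ e≤
      ; acc₀ = ≈-trans (+-congʳ (≈-reflexive (≡.trans
          (entry-minimal _ 1<S 0<S λ ()) (entry-updated (mem σ) 0<S)))) (move acc₀)
      -- The second store evaluates its right-hand side after the first, so cell 1 has to be traced
      -- back past the write to cell 0.
      ; acc₁ = ≈-trans (+-congʳ (≈-reflexive (≡.trans (entry-updated _ 1<S)
          (cong (_+ʳ term (leftChild j) e) (entry-minimal (mem σ) 0<S 1<S λ ()))))) (move acc₁)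
      }))
    where
    open Accumulating inv
    open AtNode at-node
    σ₀ σ₁ : State S
    σ₀ = ⟨ env σ [ eVar ↦ e ] , mem σ ⟩
    σ₁ = ⟨ env σ₀ , updateAt (mem σ) (fromℕ< 0<S) (const (entry (mem σ) 0 +ʳ term j e)) ⟩
    move : ∀ {x y z w} → x +ʳ (y +ʳ z) ≈ w → (x +ʳ z) +ʳ y ≈ w
    move eq = ≈-trans (+-assoc _ _ _) (≈-trans (+-congˡ (+-comm _ _)) eq)

  -- The 4 counts two stores, one assignment and the failing last test; each matrix entry then costs
  -- test, decrement and two stores.
  measure-runs : ∀ {j σ} → j < n → AtNode j σ → Runs measure σ (4 + D * 4) (Measured j)
  measure-runs {j} {σ} j<n at =
    runs-store {e = lit 0} {r = zeroˢ} refl 0<S refl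
    (runs-store {e = lit 1} {r = zeroˢ} refl 1<S refl
    (runs-assign {e = var dVar ⊗ var dVar} (cong₂ _*_ d≡ d≡) D≤S
    (runs-map leave
    (runs-countdown eVar (Accumulating j)
      (λ i → Accumulating.e≡ i , ℕ.≤-trans (Accumulating.e≤ i) D≤S) (accumulate-step j<n) record
        { at-node = record { n≡ = n≡ ; d≡ = d≡ ; j≡ = j≡ }
        ; e≡ = refl
        ; e≤ = ℕ.≤-refl
        ; acc₀ = ≈-trans (+-congʳ (≈-reflexive (≡.trans
            (entry-minimal _ 1<S 0<S λ ()) (entry-updated (mem σ) 0<S)))) (+-identityˡ _)
        ; acc₁ = ≈-trans (+-congʳ (≈-reflexive (entry-updated _ 1<S))) (+-identityˡ _)
        }))))
    where
    open AtNode at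
    leave : ∀ {σ} → Accumulating j 0 σ → Measured j σ
    leave i = record
      { at-node = Accumulating.at-node i
      ; mass₀   = ≈-trans (≈-sym (+-identityʳ _)) (Accumulating.acc₀ i)
      ; mass₁   = ≈-trans (≈-sym (+-identityʳ _)) (Accumulating.acc₁ i)
      }

  evaluate-quotient : ∀ {σ} → ¬ (entry (mem σ) 0 ≈ 0#) →
    evalScalar σ quotient ≡ just (entry (mem σ) 1 *ʳ entry (mem σ) 0 ⁻¹ʳ)
  evaluate-quotient {σ} ≉0 rewrite map-address (mem σ) 1<S | map-address (mem σ) 0<S
    | dec-false (entry (mem σ) 0 ≟ 0#) ≉0 = refl

  flip-step : ∀ {r p a b K σ} → evalScalar σ r ≡ just p → ¬ (p <ʳ 0#) → ¬ (1# <ʳ p) →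
              step (flip r a b) K σ ≡ branch p (a ++ K , σ) (b ++ K , σ)
  flip-step {p = p} eq p≮0 1≮p
    rewrite eq | dec-false (p <? 0#) p≮0 | dec-false (1# <? p) 1≮p = refl

  -- The program divides raw masses. Their common factor `total⁻¹` cancels, so the quotient is also
  -- the conditional probability for the normalised masses, whose signs are known.
  below-quotient : ∀ {j σ} → Measured j σ → ¬ (below j ≈ 0#) →
    ¬ (entry (mem σ) 0 ≈ 0#) ×
    entry (mem σ) 1 *ʳ entry (mem σ) 0 ⁻¹ʳ *ʳ below j ≈ below (leftChild j)
  below-quotient measured below≉0 = nonzero ,
    ≈-trans (*-congˡ (*-congʳ (≈-sym mass₀)))
      (≈-trans (quotient-scaled total⁻¹ nonzero) (*-congʳ mass₁))
    where
    open Measured measured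
    nonzero = λ ≈0 → below≉0⇒mass≉0 below≉0 (≈-trans (≈-sym mass₀) ≈0)

  -- By `average`, scaling by `below j` turns the flip into a sum over the children. The induction
  -- hypothesis `children` evaluates both terms, and additivity of `belowAt i` recombines them.
  flip-correct : ∀ i {j σ u} → j < n → ¬ (below j ≈ 0#) → Measured j σ →
    (∀ {k σ T} → k ≤ n + n → k ≡ leftChild j ⊎ k ≡ rightChild j → AtNode k σ → u ≤ T →
      probability T (query , σ) i *ʳ below k ≈ belowAt i k) →
    ∀ {T} → 2 + u ≤ T → probability T (branching ∷ query , σ) i *ʳ below j ≈ belowAt i j
  flip-correct i {j} {σ} {u} j<n below≉0 measured children {suc T} (s≤s time) =
    ≈-trans (*-congʳ (≈-reflexive (cong (λ o → outcomeProbability T o i) flips)))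
      (≈-trans (average _ _ p*below≈ (below-isHeap j<n))
      (≈-trans (+-cong
        (child (leftChildʷ (var resultVar)) (cong leftChild j≡) (leftChild-≤ j<n) (inj₁ refl))
        (child (rightChildʷ (var resultVar)) (cong rightChild j≡) (rightChild-≤ j<n) (inj₂ refl)))
      (≈-sym (belowAt-isHeap i j<n))))
    where
    open Measured measured
    open AtNode at-node

    0≤left : 0# ≤ʳ below (leftChild j)
    0≤left = below-nonneg (leftChild-≤ j<n)

    left≤below : below (leftChild j) ≤ʳ below j
    left≤below = ≤-respˡ-≈ (+-identityʳ _) (≤-respʳ-≈ (≈-sym (below-isHeap j<n))
      (+-mono-≤ (inj₂ ≈-refl) (below-nonneg (rightChild-≤ j<n))))

    0<below : 0# <ʳ below j
    0<below with below-nonneg (ℕ.≤-trans (ℕ.<⇒≤ j<n) (ℕ.m≤m+n n n))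
    ... | inj₁ 0<  = 0<
    ... | inj₂ 0≈  = contradiction (≈-sym 0≈) below≉0

    nonzero = proj₁ (below-quotient measured below≉0)
    p*below≈ = proj₂ (below-quotient measured below≉0)

    flips = flip-step {quotient} {a = descend (leftChildʷ (var resultVar))}
      {b = descend (rightChildʷ (var resultVar))} {K = query} (evaluate-quotient {σ} nonzero)
      (quotient≮0 p*below≈ 0≤left left≤below 0<below)
      (1≮quotient p*below≈ 0≤left left≤below 0<below)

    child : ∀ w {k} → evalWord (env σ) w ≡ k → k ≤ n + n → k ≡ leftChild j ⊎ k ≡ rightChild j →
            probability T (descend w ++ query , σ) i *ʳ below k ≈ belowAt i k
    child w {k} w≡ k≤ is-child = probability-⇓ (λ x → x *ʳ below k ≈ belowAt i k)
      (assign-step resultVar w w≡ (ℕ.≤-trans k≤ (ℕ.≤-trans (ℕ.n≤1+n _) nodes≤S)) ◅ ε)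
      (children k≤ is-child record { n≡ = n≡ ; d≡ = d≡ ; j≡ = refl }) time

  -- Where the mass below j vanishes, the division faults, but then the
  -- factor below j makes both sides zero.
  query-correct : ∀ f i {j σ T} → AtNode j σ → j ≤ n + n → suc n ≤ suc j * 2 ^ f →
                  f * (7 + D * 4) + 2 ≤ T →
                  probability T (query , σ) i *ʳ below j ≈ belowAt i j
  query-correct f i {j} {σ} {T} at j≤ depth time with j ℕ.<? n
  query-correct f i {j} {σ} {T} at j≤ depth time | no j≮n =
    probability-⇓ (λ x → x *ʳ below j ≈ belowAt i j) {u = 0} leave
      (λ {T} _ → result) (ℕ.≤-trans (ℕ.m≤n+m 2 _) time)
    where
    open AtNode at
    n≤j : n ≤ j
    n≤j = ℕ.≮⇒≥ j≮n
    exit : ∀ {K} → step (while (isInner (var resultVar)) queryBody) K σ ≡ next (K , σ)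
    exit rewrite n≡ | j≡ | ℕ.+-comm j 1 | <ᵇ-false j≮n = refl
    leave : (query , σ) ⇓[ 2 ] ([] , ⟨ env σ [ resultVar ↦ j ∸ n ] , mem σ ⟩)
    leave = exit ◅ assign-step resultVar (leafIndex (var resultVar))
      leaf≡ (ℕ.≤-trans (ℕ.m∸n≤m j n) (ℕ.≤-trans j≤ (ℕ.≤-trans (ℕ.n≤1+n _) nodes≤S))) ◅ ε
      where
      leaf≡ : evalWord (env σ) (leafIndex (var resultVar)) ≡ j ∸ n
      leaf≡ rewrite n≡ | j≡ | ℕ.+-comm j 1 = refl
    result : indicator i (j ∸ n) *ʳ below j ≈ belowAt i j
    result = ≈-reflexive (≡.sym (belowAt-leaf i n≤j))
  query-correct zero i {j} {σ} {T} at j≤ depth time | yes j<n =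
    contradiction (subst (suc n ≤_) (ℕ.*-identityʳ (suc j)) depth) (ℕ.<⇒≱ (s≤s j<n))
  query-correct (suc f) i {j} {σ} {T} at j≤ depth time | yes j<n with below j ≟ 0#
  ... | yes below≈0 = ≈-trans (≈-trans (*-congˡ below≈0) (zeroʳ _))
    (≈-sym (below≈0⇒belowAt≈0 i j≤ below≈0))
  ... | no  below≉0 =
    let σ′ , measured , σ⇓ = measure-runs j<n at (branching ∷ query) in
    probability-⇓ (λ x → x *ʳ below j ≈ belowAt i j) (enter ◅ σ⇓)
      (flip-correct i j<n below≉0 measured λ
        { k≤ (inj₁ refl) at′ → query-correct f i at′ k≤ (leftChild-depth {j = j} f depth)
        ; k≤ (inj₂ refl) at′ → query-correct f i at′ k≤ (rightChild-depth {j = j} f depth) })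
      -- A level costs the loop test, the `4 + D * 4` steps of `measure`, the flip and the move to a
      -- child, hence the 7. The closing 2 pays for leaving the loop and for writing the result.
      (ℕ.≤-trans (ℕ.≤-reflexive (split (D * 4) (f * (7 + D * 4)))) time)
    where
    open AtNode at
    enter : ∀ {K} → step (while (isInner (var resultVar)) queryBody) K σ ≡
            next (queryBody ++ while (isInner (var resultVar)) queryBody ∷ K , σ)
    enter rewrite n≡ | j≡ | ℕ.+-comm j 1 | <ᵇ-true j<n = refl
    split : ∀ x y → 5 + x + (2 + (y + 2)) ≡ 7 + x + y + 2
    split = solve-∀

  -- All terms are absorbed into multiples of `D * (1 ⊔ L)`, with 13 = 7 + 4 + 2. The maximum with 1
  -- covers a single vector, where the logarithm is 0 but the two closing steps remain.
  query-time : ∀ L → L * (7 + D * 4) + 2 ≤ 13 * (D * (1 ⊔ L))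
  query-time L = begin
    L * (7 + D * 4) + 2
      ≤⟨ ℕ.+-mono-≤
          (ℕ.*-mono-≤ (ℕ.m≤n⊔m 1 L) (ℕ.+-monoˡ-≤ (D * 4) (ℕ.*-monoʳ-≤ 7 D-positive)))
          (ℕ.*-monoʳ-≤ 2 (ℕ.*-mono-≤ D-positive (ℕ.m≤m⊔n 1 L))) ⟩
    M * (7 * D + D * 4) + 2 * (D * M)
      ≡⟨ lemma D M ⟩
    13 * (D * M) ∎
    where
    open ℕ.≤-Reasoning
    M = 1 ⊔ L
    lemma : ∀ D M → M * (7 * D + D * 4) + 2 * (D * M) ≡ 13 * (D * M)
    lemma = solve-∀

  samples : Samples query (13 * (D * (1 ⊔ ⌈log₂ suc n ⌉))) v α sums A
  -- The whole tree has normalised mass one, so multiplying by `below 0` changes nothing and brings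
  -- the goal into the form of the invariant.
  samples m i = ≈-trans (≈-sym (≈-trans (*-congˡ mass-root) (*-identityʳ _)))
    (≈-trans (query-correct ⌈log₂ suc n ⌉ (toℕ i)
        record { n≡ = refl ; d≡ = refl ; j≡ = refl } z≤n
        (subst (suc n ≤_) (≡.sym (ℕ.*-identityˡ _)) (n≤2^⌈log₂n⌉ (suc n)))
        (query-time ⌈log₂ suc n ⌉))
      (belowAt-root i))

-- Assembly of the data structure

open import Data.Nat.Base using (_*_; _⊔_)
open Reals using (ℝ)
open Machine using (mem)
open QuadraticFormSampling

theorem7p5 : ∀ {c ℓ₁ ℓ₂} (R : Reals c ℓ₁ ℓ₂) →
    ∃[ init ] ∃[ query ] ∃[ C-space ] ∃[ C-init ] ∃[ C-query ]
    ∀ (n d : ℕ) .{{_ : NonZero n}} .{{_ : NonZero d}}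
    (v : Vector (Vector (ℝ R) d) n) (α : Vector (ℝ R) n)
    (m : Vector (ℝ R) (C-space * (n * (d * d)))) →
    ∃[ σ ] Preprocesses R init (C-init * (n * (d * d))) v α m σ ×
    (∀ (A : Matrix R d) → PositiveSemidefinite R A → IsDistribution R v α A →
    Samples R query (C-query * (d * d * (1 ⊔ ⌈log₂ n ⌉))) v α (mem σ) A)
theorem7p5 R = Init.init , Query.query , 2 , 26 , 13 , λ where
  zero    d {{n≢0}} v α m → contradiction refl (ℕ.≢-nonZero⁻¹ 0 {{n≢0}})
  (suc n) d v α m →
    let σ , filled , preprocesses = Preprocessing.preprocess R v α m
    in σ , preprocesses , λ A _ dist → Querying.samples R v α (mem σ) filled A dist
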